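{- For every precomputable quasi-Polish space $\mathbf{X}$, overt choice $\mathrm{VC}_{\mathbf{X}}:\subseteq\mathcal{V}(\mathbf{X})\rightrightarrows\mathbf{X}$ is computable.
   Context: A represented space $\mathbf{X}=(X,\delta_X)$ is a set $X$ with a partial surjection $\delta_X:\subseteq\mathbb{N}^{\mathbb{N}}\to X$. A realizer of a partial multivalued function $f:\subseteq\mathbf{X}\rightrightarrows\mathbf{Y}$ is a partial $F:\subseteq\mathbb{N}^{\mathbb{N}}\to\mathbb{N}^{\mathbb{N}}$ with $\delta_Y(F(p))\in f(\delta_X(p))$ for all $p\in\mathrm{dom}(f\circ\delta_X)$; $f$ is computable if it has a computable realizer. A computable isomorphism is a computable bijection with computable inverse. Sierpinski space $\Sigma$ is $\{\top,\bot\}$ with $\delta_\Sigma(p)=\bot$ iff $p=0^\omega$. $\mathcal{O}(\mathbf{X})$ is the represented space of the open sets $U\subseteq X$ (those open in the final topology of $\delta_X$), each identified with its continuous characteristic function $\chi_U:\mathbf{X}\to\Sigma$ in the function space $\mathcal{C}(\mathbf{X},\Sigma)$ (represented via a universal machine with oracle, so that evaluation and currying are computable). In particular $\mathcal{O}(\mathbb{N})$ is the set of all subsets of $\mathbb{N}$, represented by enumerations. $\mathcal{V}(\mathbf{X})$ is the represented space of closed subsets $A$ of $\mathbf{X}$, where $A$ is identified with $\{U\in\mathcal{O}(\mathbf{X})\mid U\cap A\neq\emptyset\}\in\mathcal{O}(\mathcal{O}(\mathbf{X}))$. Overt choice $\mathrm{VC}_{\mathbf{X}}$ has domain $\{A\in\mathcal{V}(\mathbf{X})\mid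 A\neq\emptyset\}$, and $x\in\mathrm{VC}_{\mathbf{X}}(A)$ iff $x\in A$. For a transitive relation $\prec$ on $\mathbb{N}$, $I\subseteq\mathbb{N}$ is a rounded ideal if (i) $I\neq\emptyset$; (ii) $y\in I$ and $x\prec y$ imply $x\in I$; (iii) for all $x,y\in I$ there is $z\in I$ with $x\prec z$ and $y\prec z$. $\mathrm{RI}(\prec)\subseteq\mathcal{O}(\mathbb{N})$ is the subspace of all rounded ideals (with the restricted representation). $\mathbf{X}$ is a precomputable quasi-Polish space if it is computably isomorphic to $\mathrm{RI}(\prec)$ for some c.e. transitive relation $\prec\ \subseteq\mathbb{N}\times\mathbb{N}$. -}

module Defs where

open import Level using (Level; Lift; lift; 0ℓ; _⊔_) renaming (suc to lsuc)
open import Data.Fin using (Fin; toℕ)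
open import Data.Fin.Properties using (toℕ-injective)
open import Data.Nat using (ℕ; zero; suc; _+_; _<_)
open import Data.Nat.Properties using (+-suc; +-identityʳ; +-comm)
open import Data.Product using (∃; _×_; _,_; proj₁; proj₂)
open import Data.Vec using (Vec; []; _∷_; lookup)
open import Data.Vec.Relation.Binary.Pointwise.Inductive using (Pointwise; []; _∷_)
  renaming (lookup to Pointwise-lookup)
open import Function.Bundles using (_⇔_; mk⇔; Equivalence; Func; Inverse)
open import Function.Construct.Composition using (_⇔-∘_)
open import Function.Construct.Identity using (⇔-id)
open import Function.Construct.Symmetry using (⇔-sym)
open import Relation.Binary using (Rel; Setoid; Transitive)
import Relation.Binary.Construct.On as On
open import Relation.Binary.PropositionalEquality
  using (_≡_; _≢_; _≗_; refl; sym; trans; cong; cong₂; subst)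
open import Relation.Nullary using (¬_)
open import Relation.Unary using (Pred)

------------------------------------------------------------------------
-- Cantor pairing

tri : ℕ → ℕ
tri zero    = zero
tri (suc s) = suc (s + tri s)

⟨_,_⟩ : ℕ → ℕ → ℕ
⟨ a , b ⟩ = tri (a + b) + b

next : ℕ × ℕ → ℕ × ℕ
next (zero  , b) = suc b , zero
next (suc a , b) = a , suc b

unpair : ℕ → ℕ × ℕ
unpair zero    = zero , zero
unpair (suc n) = next (unpair n)

π₁ π₂ : ℕ → ℕ
π₁ n = proj₁ (unpair n)
π₂ n = proj₂ (unpair n)

private
  diagonal : ∀ s → unpair (tri s) ≡ (s , 0) →
             ∀ b a → a + b ≡ s → unpair (tri s + b) ≡ (a , b)
  diagonal s h zero a eq =
    trans (cong unpair (+-identityʳ (tri s)))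
      (trans h (cong (_, 0) (trans (sym eq) (+-identityʳ a))))
  diagonal s h (suc b) a eq =
    trans (cong unpair (+-suc (tri s) b))
      (cong next (diagonal s h b (suc a) (trans (sym (+-suc a b)) eq)))

  unpair-tri : ∀ s → unpair (tri s) ≡ (s , 0)
  unpair-tri zero    = refl
  unpair-tri (suc s) = cong next
    (trans (cong unpair (+-comm s (tri s))) (diagonal s (unpair-tri s) s 0 refl))

unpair-⟨,⟩ : ∀ a b → unpair ⟨ a , b ⟩ ≡ (a , b)
unpair-⟨,⟩ a b = diagonal (a + b) (unpair-tri (a + b)) b a refl

⟨,⟩-injective : ∀ {a b c d} → ⟨ a , b ⟩ ≡ ⟨ c , d ⟩ → a ≡ c × b ≡ d
⟨,⟩-injective {a} {b} {c} {d} eq = cong proj₁ pairs , cong proj₂ pairs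
  where
  pairs : (a , b) ≡ (c , d)
  pairs = trans (sym (unpair-⟨,⟩ a b)) (trans (cong unpair eq) (unpair-⟨,⟩ c d))

------------------------------------------------------------------------
-- Oracle computation on Baire space

Baire : Set
Baire = ℕ → ℕ

_≡[_]_ : Baire → ℕ → Baire → Set
p ≡[ n ] q = ∀ i → i < n → p i ≡ q i

-- Machines with k oracles, as unary partial recursive functions on ℕ; tuples
-- are passed through the pairing function.

data Code (k : ℕ) : Set where
  zer succ left right : Code k
  query               : Fin k → Code k
  pair comp prec      : Code k → Code k → Code k
  μ                   : Code k → Code k

-- αs ⊢ e ∙ x ⇓ y : machine e with oracles αs halts on input x with output y.
-- Primitive recursion:  prec f g ⟨a,0⟩ = f a,
--                       prec f g ⟨a,n+1⟩ = g ⟨a,⟨n,prec f g ⟨a,n⟩⟩⟩.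
-- Minimisation:         μ f ⟨a,k⟩ is the least n ≥ k with f ⟨a,n⟩ = 0.

infix 4 _⊢_∙_⇓_

data _⊢_∙_⇓_ {k} (αs : Vec Baire k) : Code k → ℕ → ℕ → Set where
  ⇓zer   : ∀ {x} → αs ⊢ zer ∙ x ⇓ 0
  ⇓succ  : ∀ {x} → αs ⊢ succ ∙ x ⇓ suc x
  ⇓left  : ∀ {x} → αs ⊢ left ∙ x ⇓ π₁ x
  ⇓right : ∀ {x} → αs ⊢ right ∙ x ⇓ π₂ x
  ⇓query : ∀ {i x} → αs ⊢ query i ∙ x ⇓ lookup αs i x
  ⇓pair  : ∀ {f g x y z} → αs ⊢ f ∙ x ⇓ y → αs ⊢ g ∙ x ⇓ z →
           αs ⊢ pair f g ∙ x ⇓ ⟨ y , z ⟩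
  ⇓comp  : ∀ {f g x y z} → αs ⊢ g ∙ x ⇓ y → αs ⊢ f ∙ y ⇓ z →
           αs ⊢ comp f g ∙ x ⇓ z
  ⇓prec0 : ∀ {f g x y} → π₂ x ≡ 0 → αs ⊢ f ∙ π₁ x ⇓ y →
           αs ⊢ prec f g ∙ x ⇓ y
  ⇓precS : ∀ {f g x n y z} → π₂ x ≡ suc n →
           αs ⊢ prec f g ∙ ⟨ π₁ x , n ⟩ ⇓ y →
           αs ⊢ g ∙ ⟨ π₁ x , ⟨ n , y ⟩ ⟩ ⇓ z →
           αs ⊢ prec f g ∙ x ⇓ z
  ⇓μ0    : ∀ {f x} → αs ⊢ f ∙ x ⇓ 0 → αs ⊢ μ f ∙ x ⇓ π₂ x
  ⇓μS    : ∀ {f x v y} → αs ⊢ f ∙ x ⇓ suc v →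
           αs ⊢ μ f ∙ ⟨ π₁ x , suc (π₂ x) ⟩ ⇓ y → αs ⊢ μ f ∙ x ⇓ y

⇓-deterministic : ∀ {k} {αs : Vec Baire k} {e x y z} →
                  αs ⊢ e ∙ x ⇓ y → αs ⊢ e ∙ x ⇓ z → y ≡ z
⇓-deterministic ⇓zer ⇓zer = refl
⇓-deterministic ⇓succ ⇓succ = refl
⇓-deterministic ⇓left ⇓left = refl
⇓-deterministic ⇓right ⇓right = refl
⇓-deterministic ⇓query ⇓query = refl
⇓-deterministic (⇓pair a b) (⇓pair a′ b′) =
  cong₂ ⟨_,_⟩ (⇓-deterministic a a′) (⇓-deterministic b b′)
⇓-deterministic (⇓comp a b) (⇓comp a′ b′) with refl ← ⇓-deterministic a a′ =
  ⇓-deterministic b b′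
⇓-deterministic (⇓prec0 _ a) (⇓prec0 _ a′) = ⇓-deterministic a a′
⇓-deterministic (⇓prec0 h _) (⇓precS h′ _ _) with () ← trans (sym h) h′
⇓-deterministic (⇓precS h _ _) (⇓prec0 h′ _) with () ← trans (sym h) h′
⇓-deterministic (⇓precS h a b) (⇓precS h′ a′ b′)
  with refl ← trans (sym h) h′
  with refl ← ⇓-deterministic a a′ = ⇓-deterministic b b′
⇓-deterministic (⇓μ0 _) (⇓μ0 _) = refl
⇓-deterministic (⇓μ0 a) (⇓μS a′ _) with () ← ⇓-deterministic a a′
⇓-deterministic (⇓μS a _) (⇓μ0 a′) with () ← ⇓-deterministic a a′
⇓-deterministic (⇓μS _ b) (⇓μS _ b′) = ⇓-deterministic b b′

⇓-resp-≗ : ∀ {k} {αs βs : Vec Baire k} → Pointwise _≗_ αs βs →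
           ∀ {e x y} → αs ⊢ e ∙ x ⇓ y → βs ⊢ e ∙ x ⇓ y
⇓-resp-≗ h ⇓zer = ⇓zer
⇓-resp-≗ h ⇓succ = ⇓succ
⇓-resp-≗ h ⇓left = ⇓left
⇓-resp-≗ h ⇓right = ⇓right
⇓-resp-≗ {βs = βs} h (⇓query {i} {x}) =
  subst (βs ⊢ query i ∙ x ⇓_) (sym (Pointwise-lookup h i x)) ⇓query
⇓-resp-≗ h (⇓pair a b) = ⇓pair (⇓-resp-≗ h a) (⇓-resp-≗ h b)
⇓-resp-≗ h (⇓comp a b) = ⇓comp (⇓-resp-≗ h a) (⇓-resp-≗ h b)
⇓-resp-≗ h (⇓prec0 z a) = ⇓prec0 z (⇓-resp-≗ h a)
⇓-resp-≗ h (⇓precS s a b) = ⇓precS s (⇓-resp-≗ h a) (⇓-resp-≗ h b)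
⇓-resp-≗ h (⇓μ0 a) = ⇓μ0 (⇓-resp-≗ h a)
⇓-resp-≗ h (⇓μS a b) = ⇓μS (⇓-resp-≗ h a) (⇓-resp-≗ h b)

-- Φ e αs q : machine e with oracles αs computes all of the sequence q.

Φ : ∀ {k} → Code k → Vec Baire k → Baire → Set
Φ e αs q = ∀ n → αs ⊢ e ∙ n ⇓ q n

⌜_⌝ : ∀ {k} → Code k → ℕ
⌜ zer ⌝      = ⟨ 0 , 0 ⟩
⌜ succ ⌝     = ⟨ 1 , 0 ⟩
⌜ left ⌝     = ⟨ 2 , 0 ⟩
⌜ right ⌝    = ⟨ 3 , 0 ⟩
⌜ query i ⌝  = ⟨ 4 , toℕ i ⟩
⌜ pair f g ⌝ = ⟨ 5 , ⟨ ⌜ f ⌝ , ⌜ g ⌝ ⟩ ⟩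
⌜ comp f g ⌝ = ⟨ 6 , ⟨ ⌜ f ⌝ , ⌜ g ⌝ ⟩ ⟩
⌜ prec f g ⌝ = ⟨ 7 , ⟨ ⌜ f ⌝ , ⌜ g ⌝ ⟩ ⟩
⌜ μ f ⌝      = ⟨ 8 , ⌜ f ⌝ ⟩

private
  tag body : ∀ {k} → Code k → ℕ
  tag zer        = 0
  tag succ       = 1
  tag left       = 2
  tag right      = 3
  tag (query _)  = 4
  tag (pair _ _) = 5
  tag (comp _ _) = 6
  tag (prec _ _) = 7
  tag (μ _)      = 8
  body zer        = 0
  body succ       = 0
  body left       = 0
  body right      = 0
  body (query i)  = toℕ i
  body (pair f g) = ⟨ ⌜ f ⌝ , ⌜ g ⌝ ⟩
  body (comp f g) = ⟨ ⌜ f ⌝ , ⌜ g ⌝ ⟩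
  body (prec f g) = ⟨ ⌜ f ⌝ , ⌜ g ⌝ ⟩
  body (μ f)      = ⌜ f ⌝

  ⌜⌝-split : ∀ {k} (e : Code k) → ⌜ e ⌝ ≡ ⟨ tag e , body e ⟩
  ⌜⌝-split zer        = refl
  ⌜⌝-split succ       = refl
  ⌜⌝-split left       = refl
  ⌜⌝-split right      = refl
  ⌜⌝-split (query _)  = refl
  ⌜⌝-split (pair _ _) = refl
  ⌜⌝-split (comp _ _) = refl
  ⌜⌝-split (prec _ _) = refl
  ⌜⌝-split (μ _)      = refl

mutual
  ⌜⌝-injective : ∀ {k} (d e : Code k) → ⌜ d ⌝ ≡ ⌜ e ⌝ → d ≡ e
  ⌜⌝-injective d e eq =
    let t , b = ⟨,⟩-injective (trans (sym (⌜⌝-split d)) (trans eq (⌜⌝-split e)))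
    in  split-injective d e t b

  private
    split-injective : ∀ {k} (d e : Code k) → tag d ≡ tag e → body d ≡ body e → d ≡ e
    split-injective zer zer refl _ = refl
    split-injective succ succ refl _ = refl
    split-injective left left refl _ = refl
    split-injective right right refl _ = refl
    split-injective (query i) (query j) refl b = cong query (toℕ-injective b)
    split-injective (pair f g) (pair f′ g′) refl b =
      let u , v = ⟨,⟩-injective b
      in  cong₂ pair (⌜⌝-injective f f′ u) (⌜⌝-injective g g′ v)
    split-injective (comp f g) (comp f′ g′) refl b =
      let u , v = ⟨,⟩-injective b
      in  cong₂ comp (⌜⌝-injective f f′ u) (⌜⌝-injective g g′ v)
    split-injective (prec f g) (prec f′ g′) refl b =
      let u , v = ⟨,⟩-injective b
      in  cong₂ prec (⌜⌝-injective f f′ u) (⌜⌝-injective g g′ v)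
    split-injective (μ f) (μ f′) refl b = cong μ (⌜⌝-injective f f′ b)

------------------------------------------------------------------------
-- Represented spaces

-- The partial surjection δ : ⊆ ℕ^ℕ → X is given by its graph.  The underlying
-- set is a setoid, and sequences are equal when they are equal pointwise.

record RepresentedSpace c ℓ : Set (lsuc (c ⊔ ℓ)) where
  field
    setoid : Setoid c ℓ
  open Setoid setoid public
    using (Carrier; _≈_) renaming (refl to ≈-refl; sym to ≈-sym; trans to ≈-trans)
  field
    δ            : Baire → Carrier → Set ℓ
    δ-resp       : ∀ {p q x y} → p ≗ q → x ≈ y → δ p x → δ q y
    δ-functional : ∀ {p x y} → δ p x → δ p y → x ≈ y
    δ-surjective : ∀ x → ∃ λ p → δ p x

private
  variable
    c ℓ c′ ℓ′ : Level

Subspace : (X : RepresentedSpace c ℓ) → Pred (RepresentedSpace.Carrier X) c′ →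
           RepresentedSpace (c ⊔ c′) ℓ
Subspace X P = record
  { setoid       = On.setoid X.setoid (proj₁ {B = P})
  ; δ            = λ p x → X.δ p (proj₁ x)
  ; δ-resp       = X.δ-resp
  ; δ-functional = X.δ-functional
  ; δ-surjective = λ x → X.δ-surjective (proj₁ x)
  }
  where module X = RepresentedSpace X

------------------------------------------------------------------------
-- Realizers and computability

module _ (X : RepresentedSpace c ℓ) (Y : RepresentedSpace c′ ℓ′) where

  private
    module X = RepresentedSpace X
    module Y = RepresentedSpace Y

  -- A partial multivalued function X ⇉ Y is a relation; its domain consists of
  -- the points that are related to something.

  MultiFunction : ∀ r → Set (c ⊔ c′ ⊔ lsuc r)
  MultiFunction r = X.Carrier → Y.Carrier → Set r

  MultiRealizes : ∀ {r} → (Baire → Baire → Set) → MultiFunction r →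
                  Set (c ⊔ ℓ ⊔ c′ ⊔ ℓ′ ⊔ r)
  MultiRealizes F f = ∀ {p x} → X.δ p x → (∃ λ y → f x y) →
                      ∃ λ q → F p q × (∃ λ y → Y.δ q y × f x y)

  MultiComputable : ∀ {r} → MultiFunction r → Set (c ⊔ ℓ ⊔ c′ ⊔ ℓ′ ⊔ r)
  MultiComputable f = ∃ λ (e : Code 1) → MultiRealizes (λ p → Φ e (p ∷ [])) f

  Realizes : (Baire → Baire → Set) → (X.Carrier → Y.Carrier) → Set (c ⊔ ℓ ⊔ ℓ′)
  Realizes F f = ∀ {p x} → X.δ p x → ∃ λ q → F p q × Y.δ q (f x)

  Computable : (X.Carrier → Y.Carrier) → Set (c ⊔ ℓ ⊔ ℓ′)
  Computable f = ∃ λ (e : Code 1) → Realizes (λ p → Φ e (p ∷ [])) f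

record ComputableIsomorphism (X : RepresentedSpace c ℓ) (Y : RepresentedSpace c′ ℓ′) :
       Set (c ⊔ ℓ ⊔ c′ ⊔ ℓ′) where
  field
    bijection       : Inverse (RepresentedSpace.setoid X) (RepresentedSpace.setoid Y)
    to-computable   : Computable X Y (Inverse.to bijection)
    from-computable : Computable Y X (Inverse.from bijection)

------------------------------------------------------------------------
-- The function space 𝒞(X,Y)

-- A name of f is ⌜e⌝ followed by an oracle r such that machine e, run with the
-- oracle r on names of points of X, realizes f.  The continuous functions are
-- those with a realizer that is computable relative to some oracle.

tail : Baire → Baire
tail q n = q (suc n)

module _ (X : RepresentedSpace c ℓ) (Y : RepresentedSpace c′ ℓ′) where

  private
    module X = RepresentedSpace X
    module Y = RepresentedSpace Y

  FunctionName : Baire → (X.Carrier → Y.Carrier) → Set (c ⊔ ℓ ⊔ ℓ′)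
  FunctionName q f = ∃ λ (e : Code 2) →
    q 0 ≡ ⌜ e ⌝ × Realizes X Y (λ p → Φ e (tail q ∷ p ∷ [])) f

  record ContinuousFunction : Set (c ⊔ ℓ ⊔ c′ ⊔ ℓ′) where
    field
      function   : Func X.setoid Y.setoid
    open Func function public renaming (to to apply; cong to apply-cong)
    field
      continuous : ∃ λ q → FunctionName q apply

  open ContinuousFunction

  𝒞 : RepresentedSpace (c ⊔ ℓ ⊔ c′ ⊔ ℓ′) (c ⊔ ℓ ⊔ ℓ′)
  𝒞 = record
    { setoid = record
      { Carrier = ContinuousFunction
      ; _≈_ = λ f g → ∀ {x y} → x X.≈ y → apply f x Y.≈ apply g y
      ; isEquivalence = record
        { refl  = λ {f} x≈y → apply-cong f x≈y
        ; sym   = λ f≈g x≈y → Y.≈-sym (f≈g (X.≈-sym x≈y))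
        ; trans = λ f≈g g≈h x≈y → Y.≈-trans (f≈g x≈y) (g≈h X.≈-refl)
        }
      }
    ; δ = λ q f → FunctionName q (apply f)
    ; δ-resp = λ q≗q′ f≈g (e , q₀ , r) → e , trans (sym (q≗q′ 0)) q₀ , λ dx →
        let s , run , ds = r dx
        in  s , (λ n → ⇓-resp-≗ ((λ i → q≗q′ (suc i)) ∷ (λ _ → refl) ∷ []) (run n))
              , Y.δ-resp (λ _ → refl) (f≈g X.≈-refl) ds
    ; δ-functional = λ {q} {f} {g} (d , q₀ , r) (e , q₀′ , r′) {x} x≈y →
        Y.≈-trans (agree f g d e (⌜⌝-injective d e (trans (sym q₀) q₀′)) r r′ x)
                  (apply-cong g x≈y)
    ; δ-surjective = continuous
    }
    where
    agree : ∀ {r} (f g : ContinuousFunction) (d e : Code 2) → d ≡ e →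
            Realizes X Y (λ p → Φ d (r ∷ p ∷ [])) (apply f) →
            Realizes X Y (λ p → Φ e (r ∷ p ∷ [])) (apply g) →
            ∀ x → apply f x Y.≈ apply g x
    agree f g d .d refl rf rg x =
      let p , dx        = X.δ-surjective x
          s , run , ds  = rf dx
          t , run′ , dt = rg dx
      in  Y.δ-functional
            (Y.δ-resp (λ n → ⇓-deterministic (run n) (run′ n)) Y.≈-refl ds) dt

------------------------------------------------------------------------
-- Sierpiński space

-- The points ⊤ and ⊥ are truth values up to logical equivalence: p names P when
-- P holds iff p is not 0^ω.  Requiring a name is what makes the representation
-- surjective; classically every truth value is ⊤ or ⊥ and has a name.

SierpinskiName : ∀ {a} → Baire → Set a → Set a
SierpinskiName p P = P ⇔ ∃ λ n → p n ≢ 0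

record TruthValue a : Set (lsuc a) where
  field
    Holds : Set a
    named : ∃ λ p → SierpinskiName p Holds

open TruthValue public

𝕊 : ∀ a → RepresentedSpace (lsuc a) a
𝕊 a = record
  { setoid = record
    { Carrier = TruthValue a
    ; _≈_ = λ P Q → Holds P ⇔ Holds Q
    ; isEquivalence = record
      { refl  = ⇔-id _
      ; sym   = ⇔-sym
      ; trans = λ P⇔Q Q⇔R → Q⇔R ⇔-∘ P⇔Q
      }
    }
  ; δ = λ p P → SierpinskiName p (Holds P)
  ; δ-resp = λ {p} {q} p≗q P⇔Q P⇔p → mk⇔
      (λ Q → let n , h = Equivalence.to P⇔p (Equivalence.from P⇔Q Q)
             in  n , λ q≡0 → h (trans (p≗q n) q≡0))
      (λ (n , h) → Equivalence.to P⇔Q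
         (Equivalence.from P⇔p (n , λ p≡0 → h (trans (sym (p≗q n)) p≡0))))
  ; δ-functional = λ P⇔p Q⇔p → ⇔-sym Q⇔p ⇔-∘ P⇔p
  ; δ-surjective = named
  }

------------------------------------------------------------------------
-- Open and overt closed sets

-- Openness in the final topology of δ: the preimage of U is open in dom δ.

FinalOpen : ∀ {a} (X : RepresentedSpace c ℓ) →
            Pred (RepresentedSpace.Carrier X) a → Set (c ⊔ ℓ ⊔ a)
FinalOpen X U = ∀ {p x} → δ p x → U x →
  ∃ λ n → ∀ {q y} → δ q y → p ≡[ n ] q → U y
  where open RepresentedSpace X

module _ (X : RepresentedSpace c ℓ) where

  open RepresentedSpace X using (Carrier)

  -- An open set is its characteristic function in 𝒞(X,𝕊).  Classically both
  -- conditions, final openness and χ ∈ 𝒞(X,𝕊), are equivalent.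

  𝒪 : RepresentedSpace (lsuc (c ⊔ ℓ)) (c ⊔ ℓ)
  𝒪 = Subspace (𝒞 X (𝕊 (c ⊔ ℓ)))
        (λ χ → FinalOpen X (λ x → Holds (ContinuousFunction.apply χ x)))

  OpenSet : Set (lsuc (c ⊔ ℓ))
  OpenSet = RepresentedSpace.Carrier 𝒪

  Contains : OpenSet → Pred Carrier (c ⊔ ℓ)
  Contains U x = Holds (ContinuousFunction.apply (proj₁ U) x)

module _ (X : RepresentedSpace c ℓ) where

  open RepresentedSpace X using (Carrier)

  Closed : Pred Carrier (c ⊔ ℓ) → Set (lsuc (c ⊔ ℓ))
  Closed A = ∃ λ (U : OpenSet X) → ∀ x → A x ⇔ (¬ Contains X U x)

  Meets : OpenSet X → Pred Carrier (c ⊔ ℓ) → Set (c ⊔ ℓ)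
  Meets U A = ∃ λ x → A x × Contains X U x

  -- A closed set A together with the point {U ∣ U ∩ A ≠ ∅} of 𝒪(𝒪(X)) that it
  -- is identified with.  Classically this point exists for every A.

  record OvertClosedSet : Set (lsuc (lsuc (c ⊔ ℓ))) where
    field
      set      : Pred Carrier (c ⊔ ℓ)
      closed   : Closed set
      hits     : OpenSet (𝒪 X)
      hits-set : ∀ U → Contains (𝒪 X) hits U ⇔ Meets U set

  open OvertClosedSet

  private
    ⊆-of-hits : ∀ A B → RepresentedSpace._≈_ (𝒪 (𝒪 X)) (hits A) (hits B) →
                ∀ x → set A x → set B x
    ⊆-of-hits A B A≈B x x∈A =
      let V , B-def = closed B
      in  Equivalence.from (B-def x) λ x∈V →
          let V-hits-A = Equivalence.from (hits-set A V) (x , x∈A , x∈V)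
              V-hits-B = Equivalence.to (A≈B {V} {V} (RepresentedSpace.≈-refl (𝒪 X) {V})) V-hits-A
              y , y∈B , y∈V = Equivalence.to (hits-set B V) V-hits-B
          in  Equivalence.to (B-def y) y∈B y∈V

    hits-of-≈ : ∀ A B → (∀ x → set A x ⇔ set B x) →
                RepresentedSpace._≈_ (𝒪 (𝒪 X)) (hits A) (hits B)
    hits-of-≈ A B A≈B {U} {V} U≈V = mk⇔
      (λ h → let x , x∈A , x∈U = Equivalence.to (hits-set A U) h
             in  Equivalence.from (hits-set B V)
                   (x , Equivalence.to (A≈B x) x∈A
                      , Equivalence.to (U≈V (RepresentedSpace.≈-refl X)) x∈U))
      (λ h → let x , x∈B , x∈V = Equivalence.to (hits-set B V) h
             in  Equivalence.from (hits-set A U)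
                   (x , Equivalence.from (A≈B x) x∈B
                      , Equivalence.from (U≈V (RepresentedSpace.≈-refl X)) x∈V))

  𝒱 : RepresentedSpace (lsuc (lsuc (c ⊔ ℓ))) (lsuc (c ⊔ ℓ))
  𝒱 = record
    { setoid = record
      { Carrier = OvertClosedSet
      ; _≈_ = λ A B → Lift (lsuc (c ⊔ ℓ)) (∀ x → set A x ⇔ set B x)
      ; isEquivalence = record
        { refl  = lift λ _ → ⇔-id _
        ; sym   = λ (lift h) → lift λ x → ⇔-sym (h x)
        ; trans = λ (lift g) (lift h) → lift λ x → h x ⇔-∘ g x
        }
      }
    ; δ = λ p A → 𝒪𝒪.δ p (hits A)
    ; δ-resp = λ {p} {q} {A} {B} p≗q (lift A≈B) →
        𝒪𝒪.δ-resp {p} {q} {x = hits A} {y = hits B} p≗q (hits-of-≈ A B A≈B)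
    ; δ-functional = λ {p} {A} {B} dA dB →
        let A≈B = 𝒪𝒪.δ-functional {p} {x = hits A} {y = hits B} dA dB
        in  lift λ x → mk⇔ (⊆-of-hits A B A≈B x)
              (⊆-of-hits B A (𝒪𝒪.≈-sym {hits A} {hits B} A≈B) x)
    ; δ-surjective = λ A → 𝒪𝒪.δ-surjective (hits A)
    }
    where module 𝒪𝒪 = RepresentedSpace (𝒪 (𝒪 X))

  VC : MultiFunction 𝒱 X (c ⊔ ℓ)
  VC A x = set A x

------------------------------------------------------------------------
-- Rounded ideals and precomputable quasi-Polish spaces

-- The value 0 in an enumeration lists nothing, so that ∅ can be enumerated.

_Enumerates_ : Baire → Pred ℕ 0ℓ → Set
p Enumerates A = ∀ n → A n ⇔ ∃ λ k → p k ≡ suc n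

-- As for 𝕊: classically, every subset of ℕ has an enumeration.

record EnumeratedSet : Set₁ where
  field
    members    : Pred ℕ 0ℓ
    enumerated : ∃ λ p → p Enumerates members

open EnumeratedSet public

𝒪ℕ : RepresentedSpace (lsuc 0ℓ) 0ℓ
𝒪ℕ = record
  { setoid = record
    { Carrier = EnumeratedSet
    ; _≈_ = λ A B → ∀ n → members A n ⇔ members B n
    ; isEquivalence = record
      { refl  = λ _ → ⇔-id _
      ; sym   = λ h n → ⇔-sym (h n)
      ; trans = λ g h n → h n ⇔-∘ g n
      }
    }
  ; δ = λ p A → p Enumerates members A
  ; δ-resp = λ p≗q A≈B pA n → mk⇔
      (λ b → let k , h = Equivalence.to (pA n) (Equivalence.from (A≈B n) b)
             in  k , trans (sym (p≗q k)) h)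
      (λ (k , h) → Equivalence.to (A≈B n)
         (Equivalence.from (pA n) (k , trans (p≗q k) h)))
  ; δ-functional = λ pA pB n → ⇔-sym (pB n) ⇔-∘ pA n
  ; δ-surjective = enumerated
  }

record RoundedIdeal (_≺_ : Rel ℕ 0ℓ) (I : Pred ℕ 0ℓ) : Set where
  field
    nonempty : ∃ λ x → I x
    lower    : ∀ {x y} → I y → x ≺ y → I x
    directed : ∀ {x y} → I x → I y → ∃ λ z → I z × x ≺ z × y ≺ z

RI : Rel ℕ 0ℓ → RepresentedSpace (lsuc 0ℓ) 0ℓ
RI _≺_ = Subspace 𝒪ℕ (λ A → RoundedIdeal _≺_ (members A))

ComputablyEnumerable : Rel ℕ 0ℓ → Set
ComputablyEnumerable R = ∃ λ (e : Code 0) → ∃ λ q →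
  Φ e [] q × (∀ x y → R x y ⇔ ∃ λ k → q k ≡ suc ⟨ x , y ⟩)

record PrecomputableQuasiPolish (X : RepresentedSpace c ℓ) : Set (lsuc 0ℓ ⊔ c ⊔ ℓ) where
  field
    _≺_          : Rel ℕ 0ℓ
    ≺-transitive : Transitive _≺_
    ≺-ce         : ComputablyEnumerable _≺_
    isomorphism  : ComputableIsomorphism X (RI _≺_)

{-# OPTIONS --safe #-}
module Submission where

-- Write U n for the set of the points whose ideal contains n.  From a name of A one
-- can semidecide whether U n meets A, by running the machine coded in the name on a
-- name of U n.  If U n meets A, in a point x, then directedness of the ideal of x
-- gives some m with n ≺ m such that U m meets A.  Hence one can search for a chain
-- n₀ ≺ n₁ ≺ … all of whose U nᵢ meet A.  The lower set of any such chain is a rounded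
-- ideal, and its point lies in A: a neighbourhood of it includes some U z with
-- z ≺ nᵢ, and U nᵢ ⊆ U z meets A, so the point is not in the complement of A.

open import Defs
open import Level using (Lift; lift; 0ℓ; _⊔_)
open import Data.Empty using (⊥-elim)
open import Data.Fin using (Fin; zero; suc; toℕ)
open import Data.List using (List; []; _∷_)
open import Data.Nat using (ℕ; zero; suc; pred; _+_; _∸_; _≤_; _<_; z≤n; s≤s)
  renaming (_⊔_ to max)
open import Data.Nat.Properties
open import Data.Product using (∃; _×_; _,_; proj₁; proj₂)
open import Data.Sum using (_⊎_; inj₁; inj₂)
open import Data.Vec using (Vec; []; _∷_; lookup)
open import Data.Vec.Relation.Binary.Pointwise.Inductive using (Pointwise; []; _∷_)
  renaming (lookup to Pointwise-lookup; map to Pointwise-map)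
open import Function.Bundles using (_⇔_; Equivalence; mk⇔; Inverse)
open import Relation.Binary using (Rel; Transitive)
open import Relation.Binary.Construct.Closure.ReflexiveTransitive using (Star; ε; _◅_; _◅◅_)
open import Relation.Binary.PropositionalEquality
open import Relation.Unary using (Pred)

-- Inverse laws of the Cantor pairing

π₁-⟨,⟩ : ∀ a b → π₁ ⟨ a , b ⟩ ≡ a
π₁-⟨,⟩ a b = cong proj₁ (unpair-⟨,⟩ a b)

π₂-⟨,⟩ : ∀ a b → π₂ ⟨ a , b ⟩ ≡ b
π₂-⟨,⟩ a b = cong proj₂ (unpair-⟨,⟩ a b)

⟨π₁,π₂⟩ : ∀ n → ⟨ π₁ n , π₂ n ⟩ ≡ n
⟨π₁,π₂⟩ zero    = refl
⟨π₁,π₂⟩ (suc n) = trans (⟨next⟩ (π₁ n) (π₂ n)) (cong suc (⟨π₁,π₂⟩ n))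
  where
  ⟨next⟩ : ∀ a b → ⟨ proj₁ (next (a , b)) , proj₂ (next (a , b)) ⟩ ≡ suc ⟨ a , b ⟩
  ⟨next⟩ zero    b = trans (+-identityʳ _) (cong suc
    (trans (cong (λ s → s + tri s) (+-identityʳ b)) (+-comm b (tri b))))
  ⟨next⟩ (suc a) b = trans (cong (λ s → tri s + suc b) (+-suc a b)) (+-suc (tri (suc a + b)) b)

-- Oracle machines

-- Composition of oracle machines: the queries become subroutine calls, so a machine for one list of
-- oracles can be used inside a machine with another list.
bind : ∀ {j k} → Code k → (Fin k → Code j) → Code j
bind zer        σ = zer
bind succ       σ = succ
bind left       σ = left
bind right      σ = right
bind (query i)  σ = σ i
bind (pair f g) σ = pair (bind f σ) (bind g σ)
bind (comp f g) σ = comp (bind f σ) (bind g σ)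
bind (prec f g) σ = prec (bind f σ) (bind g σ)
bind (μ f)      σ = μ (bind f σ)

bind-⇓ : ∀ {j k} {αs : Vec Baire j} {βs : Vec Baire k} {σ : Fin k → Code j} →
         (∀ i → Φ (σ i) αs (lookup βs i)) →
         ∀ {e x y} → βs ⊢ e ∙ x ⇓ y → αs ⊢ bind e σ ∙ x ⇓ y
bind-⇓ h ⇓zer           = ⇓zer
bind-⇓ h ⇓succ          = ⇓succ
bind-⇓ h ⇓left          = ⇓left
bind-⇓ h ⇓right         = ⇓right
bind-⇓ h (⇓query {i})   = h i _
bind-⇓ h (⇓pair a b)    = ⇓pair (bind-⇓ h a) (bind-⇓ h b)
bind-⇓ h (⇓comp a b)    = ⇓comp (bind-⇓ h a) (bind-⇓ h b)
bind-⇓ h (⇓prec0 z a)   = ⇓prec0 z (bind-⇓ h a)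
bind-⇓ h (⇓precS s a b) = ⇓precS s (bind-⇓ h a) (bind-⇓ h b)
bind-⇓ h (⇓μ0 a)        = ⇓μ0 (bind-⇓ h a)
bind-⇓ h (⇓μS a b)      = ⇓μS (bind-⇓ h a) (bind-⇓ h b)

AgreeUpTo : ∀ {k} → ℕ → Vec Baire k → Vec Baire k → Set
AgreeUpTo m = Pointwise (λ p q → p ≡[ m ] q)

AgreeUpTo-≤ : ∀ {k m n} {αs βs : Vec Baire k} → m ≤ n → AgreeUpTo n αs βs → AgreeUpTo m αs βs
AgreeUpTo-≤ m≤n = Pointwise-map (λ h i i<m → h i (<-≤-trans i<m m≤n))

-- Continuity of computations: a derivation is finite, so it contains finitely many queries, and `m`
-- exceeds all of their arguments.
⇓-finite-use : ∀ {k} {αs : Vec Baire k} {e x y} → αs ⊢ e ∙ x ⇓ y →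
               ∃ λ m → ∀ {βs} → AgreeUpTo m αs βs → βs ⊢ e ∙ x ⇓ y
⇓-finite-use ⇓zer   = 0 , λ _ → ⇓zer
⇓-finite-use ⇓succ  = 0 , λ _ → ⇓succ
⇓-finite-use ⇓left  = 0 , λ _ → ⇓left
⇓-finite-use ⇓right = 0 , λ _ → ⇓right
⇓-finite-use (⇓query {i} {x}) = suc x , λ {βs} h →
  subst (βs ⊢ query i ∙ x ⇓_) (sym (Pointwise-lookup h i x ≤-refl)) ⇓query
⇓-finite-use (⇓pair a b) =
  let m , f = ⇓-finite-use a ; n , g = ⇓-finite-use b
  in  max m n , λ h → ⇓pair (f (AgreeUpTo-≤ (m≤m⊔n m n) h)) (g (AgreeUpTo-≤ (m≤n⊔m m n) h))
⇓-finite-use (⇓comp a b) =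
  let m , f = ⇓-finite-use a ; n , g = ⇓-finite-use b
  in  max m n , λ h → ⇓comp (f (AgreeUpTo-≤ (m≤m⊔n m n) h)) (g (AgreeUpTo-≤ (m≤n⊔m m n) h))
⇓-finite-use (⇓prec0 z a) = let m , f = ⇓-finite-use a in m , λ h → ⇓prec0 z (f h)
⇓-finite-use (⇓precS s a b) =
  let m , f = ⇓-finite-use a ; n , g = ⇓-finite-use b
  in  max m n , λ h → ⇓precS s (f (AgreeUpTo-≤ (m≤m⊔n m n) h)) (g (AgreeUpTo-≤ (m≤n⊔m m n) h))
⇓-finite-use (⇓μ0 a) = let m , f = ⇓-finite-use a in m , λ h → ⇓μ0 (f h)
⇓-finite-use (⇓μS a b) =
  let m , f = ⇓-finite-use a ; n , g = ⇓-finite-use b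
  in  max m n , λ h → ⇓μS (f (AgreeUpTo-≤ (m≤m⊔n m n) h)) (g (AgreeUpTo-≤ (m≤n⊔m m n) h))

Φ-finite-use : ∀ {e : Code 1} {p q} → Φ e (p ∷ []) q → ∀ n →
               ∃ λ m → ∀ {p′ q′} → p ≡[ m ] p′ → Φ e (p′ ∷ []) q′ → q ≡[ n ] q′
Φ-finite-use run zero = 0 , λ _ _ _ ()
Φ-finite-use {e} {p} {q} run (suc n) =
  let m , f  = Φ-finite-use {e} {p} {q} run n
      m′ , g = ⇓-finite-use (run n)
  in  max m m′ , λ h run′ i i<1+n →
        agree (f (λ j j<m → h j (<-≤-trans j<m (m≤m⊔n m m′))) run′)
              (⇓-deterministic (g ((λ j j<m′ → h j (<-≤-trans j<m′ (m≤n⊔m m m′))) ∷ [])) (run′ n))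
              i (m≤n⇒m<n∨m≡n (≤-pred i<1+n))
  where
  agree : ∀ {q′} → q ≡[ n ] q′ → q n ≡ q′ n → ∀ i → i < n ⊎ i ≡ n → q i ≡ q′ i
  agree below top i (inj₁ i<n)  = below i i<n
  agree below top i (inj₂ refl) = top

μ-⇓ : ∀ {k} {αs : Vec Baire k} {f a} (F : ℕ → ℕ) → (∀ n → αs ⊢ f ∙ ⟨ a , n ⟩ ⇓ F n) →
      ∀ n → F n ≡ 0 → ∃ λ m → F m ≡ 0 × αs ⊢ μ f ∙ ⟨ a , 0 ⟩ ⇓ m
μ-⇓ {αs = αs} {f} {a} F run n Fn≡0 = search n 0 (trans (cong F (+-identityʳ n)) Fn≡0)
  where
  -- The distance `d` to a known zero makes the recursion structural; the search may stop earlier,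
  -- at a smaller zero.
  search : ∀ d i → F (d + i) ≡ 0 → ∃ λ m → F m ≡ 0 × αs ⊢ μ f ∙ ⟨ a , i ⟩ ⇓ m
  search d i h with F i in eq | run i
  ... | zero  | r = i , eq , subst (αs ⊢ μ f ∙ ⟨ a , i ⟩ ⇓_) (π₂-⟨,⟩ a i) (⇓μ0 r)
  search zero i h | suc v | r with () ← trans (sym eq) h
  search (suc d) i h | suc v | r =
    let m , Fm≡0 , s = search d (suc i) (trans (cong F (+-suc d i)) h)
    in  m , Fm≡0 , ⇓μS r (subst₂ (λ b j → αs ⊢ μ f ∙ ⟨ b , suc j ⟩ ⇓ m)
                           (sym (π₁-⟨,⟩ a i)) (sym (π₂-⟨,⟩ a i)) s)

-- Total programs on encoded data

infixr 4 _⊗_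

data Ty : Set where
  nat  : Ty
  _⊗_  : Ty → Ty → Ty
  list : Ty → Ty

⟦_⟧ : Ty → Set
⟦ nat ⟧    = ℕ
⟦ σ ⊗ τ ⟧  = ⟦ σ ⟧ × ⟦ τ ⟧
⟦ list σ ⟧ = List ⟦ σ ⟧

-- Only the empty list has code 0, so that `branch` also serves for lists and an empty stack can be
-- recognised by `μ`.
encode : ∀ τ → ⟦ τ ⟧ → ℕ
encode nat      n        = n
encode (σ ⊗ τ)  (x , y)  = ⟨ encode σ x , encode τ y ⟩
encode (list σ) []       = 0
encode (list σ) (x ∷ xs) = suc ⟨ encode σ x , encode (list σ) xs ⟩

-- Bundling a code with the total function that it computes lets the combinators below build
-- correctness proofs along with the codes.
record Program (k : ℕ) (σ τ : Ty) : Set where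
  constructor program
  field
    code    : Code k
    run     : Vec Baire k → ⟦ σ ⟧ → ⟦ τ ⟧
    correct : ∀ αs x → αs ⊢ code ∙ encode σ x ⇓ encode τ (run αs x)

open Program

natRec : ∀ {A : Set} → A → (ℕ → A → A) → ℕ → A
natRec z s zero    = z
natRec z s (suc n) = s n (natRec z s n)

caseℕ : ∀ {A : Set} → A → (ℕ → A) → ℕ → A
caseℕ z s zero    = z
caseℕ z s (suc n) = s n

module _ {k : ℕ} {αs : Vec Baire k} {f g : Code k} (a : ℕ) where

  prec-zero-⇓ : ∀ {y} → αs ⊢ f ∙ a ⇓ y → αs ⊢ prec f g ∙ ⟨ a , 0 ⟩ ⇓ y
  prec-zero-⇓ {y} r = ⇓prec0 (π₂-⟨,⟩ a 0) (subst (αs ⊢ f ∙_⇓ y) (sym (π₁-⟨,⟩ a 0)) r)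

  prec-suc-⇓ : ∀ n {y z} → αs ⊢ prec f g ∙ ⟨ a , n ⟩ ⇓ y → αs ⊢ g ∙ ⟨ a , ⟨ n , y ⟩ ⟩ ⇓ z →
               αs ⊢ prec f g ∙ ⟨ a , suc n ⟩ ⇓ z
  prec-suc-⇓ n {y} {z} r s = ⇓precS (π₂-⟨,⟩ a (suc n))
    (subst (λ b → αs ⊢ prec f g ∙ ⟨ b , n ⟩ ⇓ y) (sym (π₁-⟨,⟩ a (suc n))) r)
    (subst (λ b → αs ⊢ g ∙ ⟨ b , ⟨ n , y ⟩ ⟩ ⇓ z) (sym (π₁-⟨,⟩ a (suc n))) s)

constant : ∀ {k} → ℕ → Code k
constant zero    = zer
constant (suc n) = comp succ (constant n)

constant-⇓ : ∀ {k} {αs : Vec Baire k} n {x} → αs ⊢ constant n ∙ x ⇓ n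
constant-⇓ zero    = ⇓zer
constant-⇓ (suc n) = ⇓comp (constant-⇓ n) ⇓succ

module _ {k : ℕ} where

  private
    predRec signRec : Code k
    predRec = prec zer (comp left right)
    signRec = prec zer (constant 1)

  -- Codes have no identity instruction; taking a number apart and pairing it again does the job
  -- because the pairing is surjective.
  identity predecessor sign : Code k
  identity    = pair left right
  predecessor = comp predRec (pair zer identity)
  sign        = comp signRec (pair zer identity)

  -- Both branches are run, but g only on the actual predecessor of the scrutinee.
  branch : Code k → Code k → Code k → Code k
  branch p f g = comp (prec (comp f left) (comp g left))
                      (pair (pair identity (comp predecessor p)) (comp sign p))

  module _ {αs : Vec Baire k} where

    left-⇓ : ∀ a b → αs ⊢ left ∙ ⟨ a , b ⟩ ⇓ a
    left-⇓ a b = subst (αs ⊢ left ∙ ⟨ a , b ⟩ ⇓_) (π₁-⟨,⟩ a b) (⇓left {x = ⟨ a , b ⟩})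

    right-⇓ : ∀ a b → αs ⊢ right ∙ ⟨ a , b ⟩ ⇓ b
    right-⇓ a b = subst (αs ⊢ right ∙ ⟨ a , b ⟩ ⇓_) (π₂-⟨,⟩ a b) (⇓right {x = ⟨ a , b ⟩})

    private
      predRec-⇓ : ∀ n → αs ⊢ predRec ∙ ⟨ 0 , n ⟩ ⇓ pred n
      predRec-⇓ zero    = prec-zero-⇓ 0 ⇓zer
      predRec-⇓ (suc n) = prec-suc-⇓ 0 n (predRec-⇓ n)
        (⇓comp (right-⇓ 0 ⟨ n , pred n ⟩) (left-⇓ n (pred n)))

      signRec-⇓ : ∀ n → αs ⊢ signRec ∙ ⟨ 0 , n ⟩ ⇓ caseℕ 0 (λ _ → 1) n
      signRec-⇓ zero    = prec-zero-⇓ 0 ⇓zer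
      signRec-⇓ (suc n) = prec-suc-⇓ 0 n (signRec-⇓ n) (constant-⇓ 1)

    identity-⇓ : ∀ {n} → αs ⊢ identity ∙ n ⇓ n
    identity-⇓ {n} = subst (αs ⊢ identity ∙ n ⇓_) (⟨π₁,π₂⟩ n) (⇓pair ⇓left ⇓right)

    predecessor-⇓ : ∀ n → αs ⊢ predecessor ∙ n ⇓ pred n
    predecessor-⇓ n = ⇓comp (⇓pair ⇓zer identity-⇓) (predRec-⇓ n)

    sign-⇓ : ∀ n → αs ⊢ sign ∙ n ⇓ caseℕ 0 (λ _ → 1) n
    sign-⇓ n = ⇓comp (⇓pair ⇓zer identity-⇓) (signRec-⇓ n)

    branch-zero-⇓ : ∀ {p f g a y} → αs ⊢ p ∙ a ⇓ 0 → αs ⊢ f ∙ a ⇓ y →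
                    αs ⊢ branch p f g ∙ a ⇓ y
    branch-zero-⇓ h r =
      ⇓comp (⇓pair (⇓pair identity-⇓ (⇓comp h (predecessor-⇓ 0)))
                   (⇓comp h (sign-⇓ 0)))
            (prec-zero-⇓ _ (⇓comp (left-⇓ _ _) r))

    branch-suc-⇓ : ∀ {p f g a n y z} → αs ⊢ p ∙ a ⇓ suc n → αs ⊢ f ∙ a ⇓ y →
                   αs ⊢ g ∙ ⟨ a , n ⟩ ⇓ z → αs ⊢ branch p f g ∙ a ⇓ z
    branch-suc-⇓ {n = n} h r s =
      ⇓comp (⇓pair (⇓pair identity-⇓ (⇓comp h (predecessor-⇓ (suc n))))
                   (⇓comp h (sign-⇓ (suc n))))
            (prec-suc-⇓ _ 0 (prec-zero-⇓ _ (⇓comp (left-⇓ _ _) r)) (⇓comp (left-⇓ _ _) s))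

module _ {k : ℕ} where

  infixr 9 _⊚_
  infixr 5 _∷ᴾ_

  _⊚_ : ∀ {ρ σ τ} → Program k σ τ → Program k ρ σ → Program k ρ τ
  f ⊚ g = program (comp (code f) (code g)) (λ αs x → run f αs (run g αs x))
    λ αs x → ⇓comp (correct g αs x) (correct f αs _)

  ⟪_,_⟫ : ∀ {ρ σ τ} → Program k ρ σ → Program k ρ τ → Program k ρ (σ ⊗ τ)
  ⟪ f , g ⟫ = program (pair (code f) (code g)) (λ αs x → run f αs x , run g αs x)
    λ αs x → ⇓pair (correct f αs x) (correct g αs x)

  fst : ∀ {σ τ} → Program k (σ ⊗ τ) σ
  fst {σ} {τ} = program left (λ _ → proj₁) λ _ (x , y) → left-⇓ (encode σ x) (encode τ y)

  snd : ∀ {σ τ} → Program k (σ ⊗ τ) τ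
  snd {σ} {τ} = program right (λ _ → proj₂) λ _ (x , y) → right-⇓ (encode σ x) (encode τ y)

  unpairᴾ : Program k nat (nat ⊗ nat)
  unpairᴾ = program (pair left right) (λ _ → unpair) λ αs x → ⇓pair ⇓left ⇓right

  sucᴾ : Program k nat nat
  sucᴾ = program succ (λ _ → suc) λ _ _ → ⇓succ

  queryᴾ : Fin k → Program k nat nat
  queryᴾ i = program (query i) (λ αs → lookup αs i) λ _ _ → ⇓query

  constᴾ : ∀ {σ} → ℕ → Program k σ nat
  constᴾ n = program (constant n) (λ _ _ → n) λ _ _ → constant-⇓ n

  idᴾ : ∀ {σ} → Program k σ σ
  idᴾ = program identity (λ _ x → x) λ _ _ → identity-⇓

  pairᴾ : ∀ {σ} → Program k σ nat → Program k σ nat → Program k σ nat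
  pairᴾ f g = program (pair (code f) (code g)) (λ αs x → ⟨ run f αs x , run g αs x ⟩)
    λ αs x → ⇓pair (correct f αs x) (correct g αs x)

  []ᴾ : ∀ {σ τ} → Program k σ (list τ)
  []ᴾ = program zer (λ _ _ → []) λ _ _ → ⇓zer

  _∷ᴾ_ : ∀ {σ τ} → Program k σ τ → Program k σ (list τ) → Program k σ (list τ)
  f ∷ᴾ g = program (comp succ (pair (code f) (code g))) (λ αs x → run f αs x ∷ run g αs x)
    λ αs x → ⇓comp (⇓pair (correct f αs x) (correct g αs x)) ⇓succ

  natRecᴾ : ∀ {σ τ} → Program k σ τ → Program k (σ ⊗ nat ⊗ τ) τ → Program k (σ ⊗ nat) τ
  natRecᴾ {σ} {τ} z s = program (prec (code z) (code s))
    (λ αs (x , n) → natRec (run z αs x) (λ m y → run s αs (x , m , y)) n)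
    λ αs (x , n) → prec-⇓ αs x n
    where
    prec-⇓ : ∀ αs x n → αs ⊢ prec (code z) (code s) ∙ ⟨ encode σ x , n ⟩ ⇓
             encode τ (natRec (run z αs x) (λ m y → run s αs (x , m , y)) n)
    prec-⇓ αs x zero    = prec-zero-⇓ _ (correct z αs x)
    prec-⇓ αs x (suc n) = prec-suc-⇓ _ n (prec-⇓ αs x n) (correct s αs _)

  caseℕᴾ : ∀ {σ τ} → Program k σ nat → Program k σ τ → Program k (σ ⊗ nat) τ → Program k σ τ
  caseℕᴾ {σ} {τ} p z s = program (branch (code p) (code z) (code s))
    (λ αs x → caseℕ (run z αs x) (λ n → run s αs (x , n)) (run p αs x)) branch-⇓
    where
    branch-⇓ : ∀ αs x → αs ⊢ branch (code p) (code z) (code s) ∙ encode σ x ⇓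
               encode τ (caseℕ (run z αs x) (λ n → run s αs (x , n)) (run p αs x))
    branch-⇓ αs x with run p αs x | correct p αs x
    ... | zero  | h = branch-zero-⇓ h (correct z αs x)
    ... | suc n | h = branch-suc-⇓ h (correct z αs x) (correct s αs (x , n))

  caseListᴾ : ∀ {ρ σ τ} → Program k σ (list ρ) → Program k σ τ →
              Program k (σ ⊗ ρ ⊗ list ρ) τ → Program k σ τ
  caseListᴾ {ρ} {σ} {τ} p z s = program (branch (code p) (code z) (code s))
    (λ αs x → caseList αs x (run p αs x)) branch-⇓
    where
    caseList : Vec Baire k → ⟦ σ ⟧ → List ⟦ ρ ⟧ → ⟦ τ ⟧
    caseList αs x []       = run z αs x
    caseList αs x (y ∷ ys) = run s αs (x , y , ys)
    branch-⇓ : ∀ αs x → αs ⊢ branch (code p) (code z) (code s) ∙ encode σ x ⇓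
               encode τ (caseList αs x (run p αs x))
    branch-⇓ αs x with run p αs x | correct p αs x
    ... | []     | h = branch-zero-⇓ h (correct z αs x)
    ... | y ∷ ys | h = branch-suc-⇓ h (correct z αs x) (correct s αs (x , y , ys))

  switchᴾ : ∀ {σ τ} → List (Program k σ τ) → Program k σ τ → Program k (nat ⊗ σ) τ
  switchᴾ []       d = d ⊚ snd
  switchᴾ (b ∷ bs) d = caseℕᴾ fst (b ⊚ snd) (switchᴾ bs d ⊚ ⟪ snd , snd ⊚ fst ⟫)

predᴾ : ∀ {k} → Program k nat nat
predᴾ = program predecessor (λ _ → pred) λ _ → predecessor-⇓

-- If `a ∸ b` is 0, then `b ∸ a` decides equality. Success is the value 0, as this is what `μ` looks
-- for.
monusᴾ distinctᴾ : ∀ {k} → Program k (nat ⊗ nat) nat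
monusᴾ    = natRecᴾ idᴾ (predᴾ ⊚ snd ⊚ snd)
distinctᴾ = caseℕᴾ monusᴾ (monusᴾ ⊚ ⟪ snd , fst ⟫) (sucᴾ ⊚ snd)

monus-run : ∀ {k} (αs : Vec Baire k) a b → run monusᴾ αs (a , b) ≡ a ∸ b
monus-run αs a zero    = refl
monus-run αs a (suc b) =
  trans (cong pred (monus-run αs a b)) (pred[m∸n]≡m∸[1+n] a b)

-- The oracles have no influence on the value, so it is taken with none; runs of `distinctᴾ` with
-- other oracles reduce to the same function.
distinct : ℕ → ℕ → ℕ
distinct a b = run distinctᴾ [] (a , b)

distinct≡0⇒≡ : ∀ a b → distinct a b ≡ 0 → a ≡ b
distinct≡0⇒≡ a b h with run monusᴾ [] (a , b) in eq
... | zero = ≤-antisym (m∸n≡0⇒m≤n (trans (sym (monus-run [] a b)) eq))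
                       (m∸n≡0⇒m≤n (trans (sym (monus-run [] b a)) h))

distinct-refl : ∀ a → distinct a a ≡ 0
distinct-refl a rewrite trans (monus-run [] a a) (n∸n≡0 a) = refl

-- The universal machine

-- The machine applies the topmost instruction of its stack to its accumulator.
-- Every code is an instruction, and there are three more: ⟨9,⟨g,x⟩⟩ holds the
-- input x of g while the left component of a pair is computed, ⟨10,b⟩ turns the
-- accumulator v into ⟨b,v⟩, and ⟨11,⟨f,x⟩⟩ decides, once f has been evaluated at
-- x, whether μ f goes on.

State : Ty
State = nat ⊗ list nat

module StackMachine {k : ℕ} (step : Program k (nat ⊗ State) State)
  (step-halted : ∀ αs n v → run step αs (n , v , []) ≡ (v , [])) where

  _⟶[_,_]_ : ⟦ State ⟧ → Vec Baire k → ℕ → ⟦ State ⟧ → Set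
  s ⟶[ αs , n ] s′ = run step αs (n , s) ≡ s′

  private
    steps : Program k ((nat ⊗ State) ⊗ nat) State
    steps = natRecᴾ snd (step ⊚ ⟪ fst ⊚ fst , snd ⊚ snd ⟫)

    initial : Program k (nat ⊗ nat ⊗ nat) (nat ⊗ State)
    initial = ⟪ fst , ⟪ snd ⊚ snd , fst ⊚ snd ∷ᴾ []ᴾ ⟫ ⟫

  -- `μ` finds a number of steps after which the stack has code 0; the machine is then run again for
  -- that many steps and its accumulator is returned.
  evaluate : Code k
  evaluate = comp left (comp (code steps) (pair (code initial)
    (comp (μ (comp right (code steps))) (pair (code initial) zer))))

  module _ {αs : Vec Baire k} {n : ℕ} where

    private
      after : ℕ → ⟦ State ⟧ → ⟦ State ⟧
      after m s = run steps αs ((n , s) , m)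

      -- `after` adds steps at the end of a run, whereas a `Star` is taken apart from its beginning.
      after-suc : ∀ {s t} → s ⟶[ αs , n ] t → ∀ m → after (suc m) s ≡ after m t
      after-suc h zero    = h
      after-suc h (suc m) = cong (λ s → run step αs (n , s)) (after-suc h m)

      after-⟶ : ∀ {s s′} → Star (λ s t → s ⟶[ αs , n ] t) s s′ → ∃ λ m → after m s ≡ s′
      after-⟶ ε             = 0 , refl
      after-⟶ (s⟶t ◅ t⟶*u) =
        let m , eq = after-⟶ t⟶*u in suc m , trans (after-suc s⟶t m) eq

      height : ⟦ State ⟧ → ℕ
      height (_ , K) = encode (list nat) K

      step-fixed : ∀ s → height s ≡ 0 → run step αs (n , s) ≡ s
      step-fixed (v , []) _ = step-halted αs n v

      after-fixed : ∀ s l d → height (after l s) ≡ 0 → after (d + l) s ≡ after l s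
      after-fixed s l zero    h = refl
      after-fixed s l (suc d) h =
        trans (cong (λ t → run step αs (n , t)) (after-fixed s l d h)) (step-fixed _ h)

      -- The number of steps found by `μ` need not be the length of the given run. This does no
      -- harm, because a halted state no longer changes.
      halted-unique : ∀ s l m → height (after l s) ≡ 0 → height (after m s) ≡ 0 →
                      after l s ≡ after m s
      halted-unique s l m hl hm with ≤-total l m
      ... | inj₁ l≤m = trans (sym (after-fixed s l (m ∸ l) hl)) (cong (λ i → after i s) (m∸n+n≡m l≤m))
      ... | inj₂ m≤l = trans (cong (λ i → after i s) (sym (m∸n+n≡m m≤l))) (after-fixed s m (l ∸ m) hm)

    evaluate-⇓ : ∀ {e x y} → Star (λ s t → s ⟶[ αs , n ] t) (x , e ∷ []) (y , []) →
                 αs ⊢ evaluate ∙ ⟨ n , ⟨ e , x ⟩ ⟩ ⇓ y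
    evaluate-⇓ {e} {x} {y} r =
      let s                = x , e ∷ []
          m , m-final      = after-⟶ r
          m-halts          = cong height m-final
          l , l-halts , μ⇓ = μ-⇓ (λ i → height (after i s)) height⇓ m m-halts
          l-final          = trans (halted-unique s l m l-halts m-halts) m-final
      in  ⇓comp (⇓comp (⇓pair initial⇓ (⇓comp (⇓pair initial⇓ ⇓zer) μ⇓)) (correct steps αs ((n , s) , l)))
            (subst (λ s → αs ⊢ left ∙ encode State s ⇓ y) (sym l-final) (left-⇓ y 0))
      where
      initial⇓ : αs ⊢ code initial ∙ ⟨ n , ⟨ e , x ⟩ ⟩ ⇓ encode (nat ⊗ State) (n , x , e ∷ [])
      initial⇓ = correct initial αs (n , e , x)
      height⇓ : ∀ i → αs ⊢ comp right (code steps) ∙ ⟨ encode (nat ⊗ State) (n , x , e ∷ []) , i ⟩ ⇓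
                height (after i (x , e ∷ []))
      height⇓ i = ⇓comp (correct steps αs ((n , x , e ∷ []) , i)) (right-⇓ _ _)

-- `oracle` answers, at `(n , i , x)`, query `i` at `x` of the simulated machine. Since the
-- parameter `n` may affect the answers, a single universal machine can run a code on a whole
-- sequence of oracles.
module Universal {k : ℕ} (oracle : Program k (nat ⊗ nat ⊗ nat) nat) where

  private
    Env : Ty
    Env = nat ⊗ nat ⊗ State

    name body acc : Program k Env nat
    name = fst
    body = fst ⊚ snd
    acc  = fst ⊚ snd ⊚ snd

    stack : Program k Env (list nat)
    stack = snd ⊚ snd ⊚ snd

    _₁ _₂ : ∀ {σ} → Program k σ nat → Program k σ nat
    f ₁ = fst ⊚ unpairᴾ ⊚ f
    f ₂ = snd ⊚ unpairᴾ ⊚ f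

    hold extend retry : ∀ {σ} → Program k σ nat → Program k σ nat
    hold   = pairᴾ (constᴾ 9)
    extend = pairᴾ (constᴾ 10)
    retry  = pairᴾ (constᴾ 11)

    instructions : List (Program k Env State)
    instructions =
      ⟪ constᴾ 0 , stack ⟫ ∷
      ⟪ sucᴾ ⊚ acc , stack ⟫ ∷
      ⟪ acc ₁ , stack ⟫ ∷
      ⟪ acc ₂ , stack ⟫ ∷
      ⟪ oracle ⊚ ⟪ name , ⟪ body , acc ⟫ ⟫ , stack ⟫ ∷
      ⟪ acc , body ₁ ∷ᴾ hold (pairᴾ (body ₂) acc) ∷ᴾ stack ⟫ ∷
      ⟪ acc , body ₂ ∷ᴾ body ₁ ∷ᴾ stack ⟫ ∷
      -- At ⟨a,m+1⟩ the recursion is first run at ⟨a,m⟩; the two `extend` instructions then turn its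
      -- value `y` into ⟨a,⟨m,y⟩⟩, the input for `g`.
      caseℕᴾ (acc ₂)
        ⟪ acc ₁ , body ₁ ∷ᴾ stack ⟫
        ⟪ pairᴾ (acc ₁ ⊚ fst) snd
        , pairᴾ (constᴾ 7) (body ⊚ fst) ∷ᴾ extend snd ∷ᴾ extend (acc ₁ ⊚ fst) ∷ᴾ (body ₂ ∷ᴾ stack) ⊚ fst ⟫ ∷
      ⟪ acc , body ∷ᴾ retry (pairᴾ body acc) ∷ᴾ stack ⟫ ∷
      ⟪ body ₂ , body ₁ ∷ᴾ extend acc ∷ᴾ stack ⟫ ∷
      ⟪ pairᴾ body acc , stack ⟫ ∷
      caseℕᴾ acc
        ⟪ body ₂ ₂ , stack ⟫
        (⟪ pairᴾ (body ₂ ₁) (sucᴾ ⊚ body ₂ ₂) , pairᴾ (constᴾ 8) (body ₁) ∷ᴾ stack ⟫ ⊚ fst) ∷ []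

  step : Program k (nat ⊗ State) State
  step = caseListᴾ (snd ⊚ snd) snd
    -- The default, for an unknown tag, drops the instruction; no code produces one.
    (switchᴾ instructions (snd ⊚ snd) ⊚
      ⟪ fst ⊚ unpairᴾ ⊚ top , ⟪ fst ⊚ fst , ⟪ snd ⊚ unpairᴾ ⊚ top , ⟪ fst ⊚ snd ⊚ fst , snd ⊚ snd ⟫ ⟫ ⟫ ⟫)
    where
    top : Program k ((nat ⊗ State) ⊗ nat ⊗ list nat) nat
    top = fst ⊚ snd

  module _ (αs : Vec Baire k) (n : ℕ) where

    private
      _⟶_ : Rel ⟦ State ⟧ _
      s ⟶ s′ = run step αs (n , s) ≡ s′

      exec : ℕ → ℕ → ⟦ State ⟧ → ⟦ State ⟧
      exec t b (v , K) = run (switchᴾ instructions (snd ⊚ snd)) αs (t , n , b , v , K)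

      fetch : ∀ t b v K → (v , ⟨ t , b ⟩ ∷ K) ⟶ exec t b (v , K)
      fetch t b v K = cong (λ (t , b) → exec t b (v , K)) (unpair-⟨,⟩ t b)

    -- Induction on the derivation. The rest `K` of the stack has to be arbitrary, because a
    -- subcomputation runs on top of the instructions that its caller has left pending.
    simulate : ∀ {l} {βs : Vec Baire l} →
               (∀ i x → run oracle αs (n , toℕ i , x) ≡ lookup βs i x) →
               ∀ {e x y} → βs ⊢ e ∙ x ⇓ y → ∀ K → Star _⟶_ (x , ⌜ e ⌝ ∷ K) (y , K)
    simulate h (⇓zer {x}) K = fetch 0 0 x K ◅ ε
    simulate h (⇓succ {x}) K = fetch 1 0 x K ◅ ε
    simulate h (⇓left {x}) K = fetch 2 0 x K ◅ ε
    simulate h (⇓right {x}) K = fetch 3 0 x K ◅ ε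
    simulate h (⇓query {i} {x}) K = trans (fetch 4 (toℕ i) x K) (cong (_, K) (h i x)) ◅ ε
    simulate h (⇓pair {f} {g} {x} {y} {z} a b) K =
      trans (fetch 5 ⟨ ⌜ f ⌝ , ⌜ g ⌝ ⟩ x K)
        (cong (λ (f , g) → x , f ∷ ⟨ 9 , ⟨ g , x ⟩ ⟩ ∷ K) (unpair-⟨,⟩ ⌜ f ⌝ ⌜ g ⌝)) ◅
      simulate h a (⟨ 9 , ⟨ ⌜ g ⌝ , x ⟩ ⟩ ∷ K) ◅◅
      trans (fetch 9 ⟨ ⌜ g ⌝ , x ⟩ y K)
        (cong (λ (g , x) → x , g ∷ ⟨ 10 , y ⟩ ∷ K) (unpair-⟨,⟩ ⌜ g ⌝ x)) ◅
      simulate h b (⟨ 10 , y ⟩ ∷ K) ◅◅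
      fetch 10 y z K ◅ ε
    simulate h (⇓comp {f} {g} {x} a b) K =
      trans (fetch 6 ⟨ ⌜ f ⌝ , ⌜ g ⌝ ⟩ x K)
        (cong (λ (f , g) → x , g ∷ f ∷ K) (unpair-⟨,⟩ ⌜ f ⌝ ⌜ g ⌝)) ◅
      simulate h a (⌜ f ⌝ ∷ K) ◅◅ simulate h b K
    simulate h (⇓prec0 {f} {g} {x} π₂x≡0 a) K =
      trans (fetch 7 ⟨ ⌜ f ⌝ , ⌜ g ⌝ ⟩ x K)
        (trans (cong (caseℕ _ _) π₂x≡0) (cong (λ (f , _) → π₁ x , f ∷ K) (unpair-⟨,⟩ ⌜ f ⌝ ⌜ g ⌝))) ◅
      simulate h a K
    simulate h (⇓precS {f} {g} {x} {n} {y} π₂x≡1+n a b) K =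
      trans (fetch 7 ⟨ ⌜ f ⌝ , ⌜ g ⌝ ⟩ x K)
        (trans (cong (caseℕ _ _) π₂x≡1+n)
          (cong (λ (_ , g′) → ⟨ π₁ x , n ⟩ , ⌜ prec f g ⌝ ∷ ⟨ 10 , n ⟩ ∷ ⟨ 10 , π₁ x ⟩ ∷ g′ ∷ K)
            (unpair-⟨,⟩ ⌜ f ⌝ ⌜ g ⌝))) ◅
      simulate h a (⟨ 10 , n ⟩ ∷ ⟨ 10 , π₁ x ⟩ ∷ ⌜ g ⌝ ∷ K) ◅◅
      fetch 10 n y (⟨ 10 , π₁ x ⟩ ∷ ⌜ g ⌝ ∷ K) ◅
      fetch 10 (π₁ x) ⟨ n , y ⟩ (⌜ g ⌝ ∷ K) ◅
      simulate h b K
    simulate h (⇓μ0 {f} {x} a) K =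
      fetch 8 ⌜ f ⌝ x K ◅
      simulate h a (⟨ 11 , ⟨ ⌜ f ⌝ , x ⟩ ⟩ ∷ K) ◅◅
      trans (fetch 11 ⟨ ⌜ f ⌝ , x ⟩ 0 K)
        (cong (λ (_ , x) → π₂ x , K) (unpair-⟨,⟩ ⌜ f ⌝ x)) ◅ ε
    simulate h (⇓μS {f} {x} {v} a b) K =
      fetch 8 ⌜ f ⌝ x K ◅
      simulate h a (⟨ 11 , ⟨ ⌜ f ⌝ , x ⟩ ⟩ ∷ K) ◅◅
      trans (fetch 11 ⟨ ⌜ f ⌝ , x ⟩ (suc v) K)
        (cong (λ (f , x) → ⟨ π₁ x , suc (π₂ x) ⟩ , ⟨ 8 , f ⟩ ∷ K) (unpair-⟨,⟩ ⌜ f ⌝ x)) ◅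
      simulate h b K

  open StackMachine step (λ _ _ _ → refl) public renaming (evaluate to universal) using ()

  universal-⇓ : ∀ {αs : Vec Baire k} {n l} {βs : Vec Baire l} →
                (∀ i x → run oracle αs (n , toℕ i , x) ≡ lookup βs i x) →
                ∀ {e x y} → βs ⊢ e ∙ x ⇓ y → αs ⊢ universal ∙ ⟨ n , ⟨ ⌜ e ⌝ , x ⟩ ⟩ ⇓ y
  universal-⇓ {αs} {n} h r = StackMachine.evaluate-⇓ step (λ _ _ _ → refl) (simulate αs n h r [])

-- Rounded ideals

-- All of `s` follows the prefix of `r`, so nothing that `s` enumerates is lost. This provides names
-- of one ideal that begin like a name of another.
splice : ℕ → Baire → Baire → Baire
splice zero    r s j       = s j
splice (suc m) r s zero    = r zero
splice (suc m) r s (suc j) = splice m (tail r) s j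

splice-≡[] : ∀ m r s → r ≡[ m ] splice m r s
splice-≡[] (suc m) r s zero    _         = refl
splice-≡[] (suc m) r s (suc j) (s≤s j<m) = splice-≡[] m (tail r) s j j<m

splice-enumerates : ∀ m r s {A} → (∀ j → j < m → ∀ n → r j ≡ suc n → A n) →
                    s Enumerates A → splice m r s Enumerates A
splice-enumerates zero    r s h sA n = sA n
splice-enumerates (suc m) r s {A} h sA n = mk⇔
  (λ An → let k , eq = Equivalence.to (ih n) An in suc k , eq)
  (λ { (zero , eq) → h zero (s≤s z≤n) n eq ; (suc k , eq) → Equivalence.from (ih n) (k , eq) })
  where
  ih : splice m (tail r) s Enumerates A
  ih = splice-enumerates m (tail r) s (λ j j<m → h (suc j) (s≤s j<m)) sA

LowerSet : Rel ℕ 0ℓ → (ℕ → ℕ) → Pred ℕ 0ℓ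
LowerSet _≺_ N m = ∃ λ i → m ≺ N i

module _ {_≺_ : Rel ℕ 0ℓ} (≺-transitive : Transitive _≺_) where

  -- The elements listed are absorbed one at a time by directedness, and transitivity carries the
  -- earlier bounds along. An entry 0 lists nothing and leaves `z` as it is.
  finite-bound : ∀ {I r} → RoundedIdeal _≺_ I → r Enumerates I → ∀ m →
                 ∃ λ z → I z × (∀ j → j < m → ∀ n → r j ≡ suc n → n ≺ z)
  finite-bound I-ideal r-I zero = let x , x∈I = RoundedIdeal.nonempty I-ideal in x , x∈I , λ _ ()
  finite-bound {I} {r} I-ideal r-I (suc m) with finite-bound I-ideal r-I m | r m in eq
  ... | z , z∈I , bound | zero =
    z , z∈I , λ j j<1+m n rj → case j (m≤n⇒m<n∨m≡n (≤-pred j<1+m)) n rj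
    where
    case : ∀ j → j < m ⊎ j ≡ m → ∀ n → r j ≡ suc n → n ≺ z
    case j (inj₁ j<m)  n rj = bound j j<m n rj
    case j (inj₂ refl) n rj with () ← trans (sym eq) rj
  ... | z , z∈I , bound | suc x =
    let z′ , z′∈I , z≺z′ , x≺z′ = RoundedIdeal.directed I-ideal z∈I (Equivalence.from (r-I x) (m , eq))
        case : ∀ j → j < m ⊎ j ≡ m → ∀ n → r j ≡ suc n → n ≺ z′
        case = λ { j (inj₁ j<m) n rj → ≺-transitive (bound j j<m n rj) z≺z′
                 ; j (inj₂ refl) n rj → subst (_≺ z′) (suc-injective (trans (sym eq) rj)) x≺z′ }
    in  z′ , z′∈I , λ j j<1+m → case j (m≤n⇒m<n∨m≡n (≤-pred j<1+m))

  module _ {N : ℕ → ℕ} (N-ascending : ∀ i → N i ≺ N (suc i)) where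

    private
      raise : ∀ d {m i} → m ≺ N i → m ≺ N (d + i)
      raise zero    h = h
      raise (suc d) h = ≺-transitive (raise d h) (N-ascending _)

    LowerSet-ideal : RoundedIdeal _≺_ (LowerSet _≺_ N)
    LowerSet-ideal = record
      { nonempty = N 0 , 1 , N-ascending 0
      ; lower    = λ (i , y≺Ni) x≺y → i , ≺-transitive x≺y y≺Ni
      -- Both elements lie below the term with index `j + i`, which is itself in the lower set
      -- because it lies below its successor in the chain.
      ; directed = λ {x} {y} (i , x≺Ni) (j , y≺Nj) →
          N (j + i) , (suc (j + i) , N-ascending (j + i)) , raise j x≺Ni ,
          subst (λ l → y ≺ N l) (+-comm i j) (raise i y≺Nj)
      }

-- Basic open sets

-- Applied to each entry of an enumeration, this gives a name of the truth value of "`n` is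
-- enumerated".
selectᴾ : ∀ {k} → Program k (nat ⊗ nat) nat
selectᴾ = caseℕᴾ fst (constᴾ 0)
  (caseℕᴾ (distinctᴾ ⊚ ⟪ snd , snd ⊚ fst ⟫) (constᴾ 1) (constᴾ 0))

select : ℕ → ℕ → ℕ
select s n = caseℕ 0 (λ m → caseℕ 1 (λ _ → 0) (distinct m n)) s

select≢0⇒≡ : ∀ s n → select s n ≢ 0 → s ≡ suc n
select≢0⇒≡ zero    n h = ⊥-elim (h refl)
select≢0⇒≡ (suc m) n h with distinct m n in eq
... | zero  = cong suc (distinct≡0⇒≡ m n eq)
... | suc _ = ⊥-elim (h refl)

select-self : ∀ n → select (suc n) n ≢ 0
select-self n h with distinct n n | distinct-refl n
select-self n () | zero | refl

-- Membership is witnessed by one nonzero output, whose computation reads only a finite part of the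
-- name of the point.
open-of-realizer : ∀ {c ℓ a} (X : RepresentedSpace c ℓ) (e : Code 2) r
  (χ : RepresentedSpace.Carrier X → TruthValue a) →
  Realizes X (𝕊 a) (λ p → Φ e (r ∷ p ∷ [])) χ → FinalOpen X (λ x → Holds (χ x))
open-of-realizer X e r χ realizes δpx x∈U =
  let s , run , s-name = realizes δpx
      k , sk≢0         = Equivalence.to s-name x∈U
      m , use          = ⇓-finite-use (run k)
  in  m , λ δqy p≡q →
        let s′ , run′ , s′-name = realizes δqy
            sk≡s′k = ⇓-deterministic (use ((λ _ _ → refl) ∷ p≡q ∷ [])) (run′ k)
        in  Equivalence.from s′-name (k , λ s′k≡0 → sk≢0 (trans sk≡s′k s′k≡0))

module Basic {c ℓ} (X : RepresentedSpace c ℓ) {_≺_ : Rel ℕ 0ℓ} (≺-transitive : Transitive _≺_)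
             (iso : ComputableIsomorphism X (RI _≺_)) where

  open RepresentedSpace X
  open ComputableIsomorphism iso
  open Inverse bijection using (to; to-cong; strictlyInverseʳ)

  ideal : Carrier → Pred ℕ 0ℓ
  ideal x = members (proj₁ (to x))

  ideal-rounded : ∀ x → RoundedIdeal _≺_ (ideal x)
  ideal-rounded x = proj₂ (to x)

  -- Abstract because its Gödel number is far too large to be computed.
  abstract
    basicCode : Code 2
    basicCode = comp (code selectᴾ)
      (pair (bind (proj₁ to-computable) (λ _ → query (suc zero))) (comp (query zero) zer))

    basicCode-⇓ : ∀ {r p s} → Φ (proj₁ to-computable) (p ∷ []) s →
                  Φ basicCode (r ∷ p ∷ []) (λ k → select (s k) (r 0))
    basicCode-⇓ {r} {p} {s} run k =
      ⇓comp (⇓pair (bind-⇓ (λ { zero _ → ⇓query }) (run k)) (⇓comp ⇓zer ⇓query))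
            (correct selectᴾ (r ∷ p ∷ []) (s k , r 0))

  -- All basic open sets share one machine and `n` enters only as a constant oracle, so these names
  -- are computable uniformly in `n`.
  basicName : ℕ → Baire
  basicName n = caseℕ ⌜ basicCode ⌝ (λ _ → n)

  private
    ∈-basic : ℕ → Carrier → Set (c ⊔ ℓ)
    ∈-basic n x = Lift (c ⊔ ℓ) (ideal x n)

    basic-realized : ∀ n {p x} → δ p x → ∃ λ s →
      Φ basicCode (tail (basicName n) ∷ p ∷ []) s × SierpinskiName s (∈-basic n x)
    basic-realized n {p} {x} δpx =
      let s , run , s-name = proj₂ to-computable δpx
      in  (λ k → select (s k) n)
          , basicCode-⇓ run
          , mk⇔ (λ (lift n∈x) → let k , sk≡1+n = Equivalence.to (s-name n) n∈x
                                 in  k , λ h → select-self n (trans (cong (λ t → select t n) (sym sk≡1+n)) h))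
                (λ (k , h) → lift (Equivalence.from (s-name n) (k , select≢0⇒≡ (s k) n h)))

    χ : ℕ → Carrier → TruthValue (c ⊔ ℓ)
    χ n x = record
      { Holds = ∈-basic n x
      ; named = let _ , δpx = δ-surjective x ; s , _ , s-name = basic-realized n δpx in s , s-name
      }

  basicName-names : ∀ n → FunctionName X (𝕊 (c ⊔ ℓ)) (basicName n) (χ n)
  basicName-names n = basicCode , refl , basic-realized n

  basic : ℕ → OpenSet X
  basic n = record
    { function   = record
      { to   = χ n
      ; cong = λ x≈y → mk⇔ (λ (lift h) → lift (Equivalence.to (to-cong x≈y n) h))
                           (λ (lift h) → lift (Equivalence.from (to-cong x≈y n) h))
      }
    ; continuous = basicName n , basicName-names n
    } , open-of-realizer X basicCode (tail (basicName n)) (χ n) (basic-realized n)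

  from-realized : ∀ {r x} → r Enumerates ideal x →
                  ∃ λ q → Φ (proj₁ from-computable) (r ∷ []) q × δ q x
  from-realized {x = x} r-x =
    let q , run , δq = proj₂ from-computable {x = to x} r-x
    in  q , run , δ-resp (λ _ → refl) (strictlyInverseʳ x) δq

  -- Openness depends on finitely many values of a name of `x`, and these on a finite prefix of an
  -- enumeration of its ideal. Let `z` bound that prefix inside the ideal. If the ideal of `y`
  -- contains `z`, it contains all that the prefix lists, so the prefix extends to an enumeration of
  -- this ideal, and the resulting name of `y` agrees with that of `x` as far as needed.
  basic-is-base : ∀ {a} {V : Pred Carrier a} → FinalOpen X V → ∀ {x} → V x →
                  ∃ λ z → ideal x z × (∀ y → ideal y z → V y)
  basic-is-base V-open {x} x∈V =
    let r , r-x         = enumerated (proj₁ (to x))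
        q , run , δqx   = from-realized r-x
        n , near        = V-open δqx x∈V
        m , use         = Φ-finite-use {e = proj₁ from-computable} run n
        z , z∈x , bound = finite-bound ≺-transitive (ideal-rounded x) r-x m
    in  z , z∈x , λ y z∈y →
          let s , s-y       = enumerated (proj₁ (to y))
              r′-y          = splice-enumerates m r s
                (λ j j<m i rj → RoundedIdeal.lower (ideal-rounded y) z∈y (bound j j<m i rj)) s-y
              q′ , run′ , δq′y = from-realized {x = y} r′-y
          in  near δq′y (use (splice-≡[] m r s) run′)

-- Overt choice

-- The state c of the search is 0, or suc n when n is the element last found; v is
-- an entry suc ⟨x,y⟩ of the enumeration of ≺, and s is a value of the name of the
-- truth value of "U y meets A".  The check is passed when it returns 0.

checkᴾ : Program 1 ((nat ⊗ nat) ⊗ nat) nat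
checkᴾ = caseℕᴾ (snd ⊚ fst) (constᴾ 1)
  (caseℕᴾ (snd ⊚ fst) (constᴾ 1)
    (caseℕᴾ (fst ⊚ fst ⊚ fst ⊚ fst) (constᴾ 0)
      (distinctᴾ ⊚ ⟪ snd , fst ⊚ unpairᴾ ⊚ snd ⊚ fst ⊚ fst ⟫)))

check : ℕ → ℕ → ℕ → ℕ
check c v s = caseℕ 1 (λ m → caseℕ 1 (λ _ → caseℕ 0 (λ n → distinct n (π₁ m)) c) s) v

check≡0⇒ : ∀ c v s → check c v s ≡ 0 →
           ∃ λ x → ∃ λ y → v ≡ suc ⟨ x , y ⟩ × s ≢ 0 × (∀ n → c ≡ suc n → n ≡ x)
check≡0⇒ c (suc m) (suc _) h = π₁ m , π₂ m , cong suc (sym (⟨π₁,π₂⟩ m)) , (λ ()) ,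
  λ { n refl → distinct≡0⇒≡ n (π₁ m) h }

⇒check≡0 : ∀ c {x y} s → s ≢ 0 → (∀ n → c ≡ suc n → n ≡ x) → check c (suc ⟨ x , y ⟩) s ≡ 0
⇒check≡0 c       zero s≢0 _ = ⊥-elim (s≢0 refl)
⇒check≡0 zero    (suc _) _ _ = refl
⇒check≡0 (suc n) {x} {y} (suc _) _ extends =
  trans (cong (distinct n) (trans (π₁-⟨,⟩ x y) (sym (extends n refl)))) (distinct-refl n)

-- One entry of the enumeration of the lower set of the chain: `x` is listed when `v` records a pair
-- `x ≺ y` and the state `c` holds `y`; otherwise nothing is.
belowᴾ : Program 1 (nat ⊗ nat) nat
belowᴾ = caseℕᴾ fst (constᴾ 0)
  (caseℕᴾ (snd ⊚ fst) (constᴾ 0)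
    (caseℕᴾ (distinctᴾ ⊚ ⟪ snd , snd ⊚ unpairᴾ ⊚ snd ⊚ fst ⟫)
      (sucᴾ ⊚ fst ⊚ unpairᴾ ⊚ snd ⊚ fst) (constᴾ 0)))

below : ℕ → ℕ → ℕ
below v c = caseℕ 0 (λ m → caseℕ 0 (λ n → caseℕ (suc (π₁ m)) (λ _ → 0) (distinct n (π₂ m))) c) v

below≡suc⇒ : ∀ v c {x} → below v c ≡ suc x → ∃ λ y → v ≡ suc ⟨ x , y ⟩ × c ≡ suc y
below≡suc⇒ (suc m) (suc n) h with distinct n (π₂ m) in eq
below≡suc⇒ (suc m) (suc n) refl | zero =
  π₂ m , cong suc (sym (⟨π₁,π₂⟩ m)) , cong suc (distinct≡0⇒≡ n (π₂ m) eq)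

below-⟨,⟩ : ∀ x y → below (suc ⟨ x , y ⟩) (suc y) ≡ suc x
below-⟨,⟩ x y = trans
  (cong (λ (a , b) → caseℕ (suc a) (λ _ → 0) (distinct y b)) (unpair-⟨,⟩ x y))
  (cong (caseℕ (suc x) (λ _ → 0)) (distinct-refl y))

module OvertChoice {c ℓ} (X : RepresentedSpace c ℓ) (qp : PrecomputableQuasiPolish X) where

  open PrecomputableQuasiPolish qp
  open RepresentedSpace X
  open Basic X ≺-transitive isomorphism
  open ComputableIsomorphism isomorphism
  open Inverse bijection using (from; strictlyInverseˡ)

  private
    Q : Baire
    Q = proj₁ (proj₂ ≺-ce)

    Q-enumerates : ∀ x y → x ≺ y ⇔ ∃ λ k → Q k ≡ suc ⟨ x , y ⟩
    Q-enumerates = proj₂ (proj₂ (proj₂ ≺-ce))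

    Qᴾ : Program 1 nat nat
    Qᴾ = program (bind (proj₁ ≺-ce) λ ()) (λ _ → Q)
      λ _ n → bind-⇓ (λ ()) (proj₁ (proj₂ (proj₂ ≺-ce)) n)

    -- The machine coded in a name of an overt set reads two oracles: the tail of that name, and the
    -- name of an open set, here `basicName n`.
    oracleᴾ : Program 1 (nat ⊗ nat ⊗ nat) nat
    oracleᴾ = caseℕᴾ (fst ⊚ snd) (queryᴾ zero ⊚ sucᴾ ⊚ snd ⊚ snd)
      (caseℕᴾ (snd ⊚ snd) (constᴾ ⌜ basicCode ⌝) (fst ⊚ fst) ⊚ fst)

    open Universal oracleᴾ using (universal; universal-⇓)

    -- A search index `w` is a pair of a time `t` and an index `j` into the enumeration of `≺`; the
    -- candidate is the larger element of entry `j`. An entry 0 gives a meaningless value, which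
    -- `check` rejects.
    candidate : ℕ → ℕ
    candidate w = π₂ (pred (Q (π₂ w)))

    entryᴾ candidateᴾ : Program 1 (nat ⊗ nat) nat
    entryᴾ     = Qᴾ ⊚ snd ⊚ unpairᴾ ⊚ snd
    candidateᴾ = snd ⊚ unpairᴾ ⊚ predᴾ ⊚ entryᴾ

  -- Meeting `A` is only semidecidable, so `advance` searches through times and pairs of `≺`
  -- simultaneously. The code run by `meets` is the value of the input name at 0.
  meets test advance chain idealCode choice : Code 1
  meets     = comp universal (pair left (pair (comp (query zero) zer) right))
  test      = comp (code checkᴾ)
                (pair (code ⟪ fst , entryᴾ ⟫) (comp meets (code ⟪ candidateᴾ , fst ⊚ unpairᴾ ⊚ snd ⟫)))
  advance   = comp (comp succ (code candidateᴾ)) (pair identity (comp (μ test) (pair identity zer)))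
  chain     = prec zer (comp advance (comp right right))
  idealCode = comp (code belowᴾ)
                (pair (comp (code Qᴾ) left) (comp chain (pair zer right)))
  choice    = bind (proj₁ from-computable) (λ _ → idealCode)

  -- Correctness of the search

  module _ {p : Baire} (A : OvertClosedSet X) (p-names : RepresentedSpace.δ (𝒱 X) p A) where

    open OvertClosedSet A

    private
      αs : Vec Baire 1
      αs = p ∷ []

      meets-name : ∀ n → ∃ λ s → Φ (proj₁ p-names) (tail p ∷ basicName n ∷ []) s ×
                   SierpinskiName s (Contains (𝒪 X) hits (basic n))
      meets-name n = proj₂ (proj₂ p-names) {basicName n} {basic n} (basicName-names n)

      S : ℕ → Baire
      S n = proj₁ (meets-name n)

    Hit : ℕ → Set (c ⊔ ℓ)
    Hit n = ∃ λ x → set x × ideal x n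

    private
      S≢0⇒Hit : ∀ n t → S n t ≢ 0 → Hit n
      S≢0⇒Hit n t h =
        let x , x∈A , lift n∈x = Equivalence.to (hits-set (basic n))
              (Equivalence.from (proj₂ (proj₂ (meets-name n))) (t , h))
        in  x , x∈A , n∈x

      Hit⇒S≢0 : ∀ {n} → Hit n → ∃ λ t → S n t ≢ 0
      Hit⇒S≢0 {n} (x , x∈A , n∈x) = Equivalence.to (proj₂ (proj₂ (meets-name n)))
        (Equivalence.from (hits-set (basic n)) (x , x∈A , lift n∈x))

      meets-⇓ : ∀ n t → αs ⊢ meets ∙ ⟨ n , t ⟩ ⇓ S n t
      meets-⇓ n t = ⇓comp
        (⇓pair (left-⇓ n t) (⇓pair (⇓comp ⇓zer
          (subst (αs ⊢ query zero ∙ 0 ⇓_) (proj₁ (proj₂ p-names)) ⇓query)) (right-⇓ n t)))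
        (universal-⇓ (λ { zero _ → refl ; (suc zero) zero → refl ; (suc zero) (suc _) → refl })
          (proj₁ (proj₂ (meets-name n)) t))

      candidate-⇓ : ∀ a w → αs ⊢ code candidateᴾ ∙ ⟨ a , w ⟩ ⇓ candidate w
      candidate-⇓ a w = correct candidateᴾ αs (a , w)

      checkAt : ℕ → ℕ → ℕ
      checkAt a w = check a (Q (π₂ w)) (S (candidate w) (π₁ w))

      test-⇓ : ∀ a w → αs ⊢ test ∙ ⟨ a , w ⟩ ⇓ checkAt a w
      test-⇓ a w = ⇓comp
        (⇓pair (correct ⟪ fst , entryᴾ ⟫ αs (a , w))
               (⇓comp (correct ⟪ candidateᴾ , fst ⊚ unpairᴾ ⊚ snd ⟫ αs (a , w)) (meets-⇓ (candidate w) (π₁ w))))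
        (correct checkᴾ αs ((a , Q (π₂ w)) , S (candidate w) (π₁ w)))

      candidate-≡ : ∀ w {x y} → Q (π₂ w) ≡ suc ⟨ x , y ⟩ → candidate w ≡ y
      candidate-≡ w {x} {y} eq = trans (cong (λ v → π₂ (pred v)) eq) (π₂-⟨,⟩ x y)

    -- The pair `x ≺ y` only ensures that the search halts. It may stop at another pair, but passing
    -- the check gives all that is claimed about `z`. For `a` equal to 0 the search has nothing to
    -- extend.
    advance-⇓ : ∀ a {x y} → (∀ n → a ≡ suc n → n ≡ x) → x ≺ y → Hit y →
      ∃ λ z → αs ⊢ advance ∙ a ⇓ suc z × Hit z × (∀ n → a ≡ suc n → n ≺ z)
    advance-⇓ a {x} {y} extends x≺y y-hit =
      let t , St≢0     = Hit⇒S≢0 y-hit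
          j , Qj≡      = Equivalence.to (Q-enumerates x y) x≺y
          w , w≡0 , μ⇓ = μ-⇓ (checkAt a) (test-⇓ a) ⟨ t , j ⟩ (found t j St≢0 Qj≡)
      in  conclude w μ⇓ (check≡0⇒ a (Q (π₂ w)) (S (candidate w) (π₁ w)) w≡0)
      where
      conclude : ∀ w → αs ⊢ μ test ∙ ⟨ a , 0 ⟩ ⇓ w →
                 (∃ λ x → ∃ λ y → Q (π₂ w) ≡ suc ⟨ x , y ⟩ × S (candidate w) (π₁ w) ≢ 0 ×
                                  (∀ n → a ≡ suc n → n ≡ x)) →
                 ∃ λ z → αs ⊢ advance ∙ a ⇓ suc z × Hit z × (∀ n → a ≡ suc n → n ≺ z)
      conclude w μ⇓ (x′ , y′ , Q≡ , S≢0 , extends′) =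
        candidate w
        , ⇓comp (⇓pair identity-⇓ (⇓comp (⇓pair identity-⇓ ⇓zer) μ⇓)) (⇓comp (candidate-⇓ a w) ⇓succ)
        , S≢0⇒Hit (candidate w) (π₁ w) S≢0
        , λ n a≡1+n → subst₂ _≺_ (sym (extends′ n a≡1+n)) (sym (candidate-≡ w Q≡))
                        (Equivalence.from (Q-enumerates x′ y′) (π₂ w , Q≡))

      found : ∀ t j → S y t ≢ 0 → Q j ≡ suc ⟨ x , y ⟩ → checkAt a ⟨ t , j ⟩ ≡ 0
      found t j St≢0 Qj≡ = trans
        (cong₂ (check a) Q≡ (cong₂ S (candidate-≡ ⟨ t , j ⟩ Q≡) (π₁-⟨,⟩ t j)))
        (⇒check≡0 a (S y t) St≢0 extends)
        where
        Q≡ : Q (π₂ ⟨ t , j ⟩) ≡ suc ⟨ x , y ⟩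
        Q≡ = trans (cong Q (π₂-⟨,⟩ t j)) Qj≡

    module _ {N : ℕ → ℕ} (N-ascending : ∀ i → N i ≺ N (suc i)) (N-hit : ∀ i → Hit (N i))
             (N-first : αs ⊢ advance ∙ 0 ⇓ suc (N 0))
             (N-next : ∀ i → αs ⊢ advance ∙ suc (N i) ⇓ suc (N (suc i))) where

      -- State 0 precedes the first element, so `N i` is held by the state with index `suc i`.
      state : ℕ → ℕ
      state zero    = 0
      state (suc i) = suc (N i)

      chain-⇓ : ∀ i → αs ⊢ chain ∙ ⟨ 0 , i ⟩ ⇓ state i
      chain-⇓ zero    = prec-zero-⇓ 0 ⇓zer
      chain-⇓ (suc i) = prec-suc-⇓ 0 i (chain-⇓ i)
        (⇓comp (⇓comp (right-⇓ 0 ⟨ i , state i ⟩) (right-⇓ i (state i))) (advances i))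
        where
        advances : ∀ i → αs ⊢ advance ∙ state i ⇓ state (suc i)
        advances zero    = N-first
        advances (suc i) = N-next i

      r : Baire
      r k = below (Q (π₁ k)) (state (π₂ k))

      idealCode-⇓ : Φ idealCode αs r
      idealCode-⇓ k = ⇓comp
        (⇓pair (⇓comp ⇓left (correct Qᴾ αs (π₁ k))) (⇓comp (⇓pair ⇓zer ⇓right) (chain-⇓ (π₂ k))))
        (correct belowᴾ αs (Q (π₁ k) , state (π₂ k)))

      I : Pred ℕ 0ℓ
      I = LowerSet _≺_ N

      r-enumerates : r Enumerates I
      r-enumerates x = mk⇔
        (λ (i , x≺Ni) →
          let j , Qj≡ = Equivalence.to (Q-enumerates x (N i)) x≺Ni
          in  ⟨ j , suc i ⟩ , trans
                (cong₂ below (trans (cong Q (π₁-⟨,⟩ j (suc i))) Qj≡) (cong state (π₂-⟨,⟩ j (suc i))))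
                (below-⟨,⟩ x (N i)))
        (λ (k , rk≡1+x) →
          let y , Q≡ , state≡ = below≡suc⇒ (Q (π₁ k)) (state (π₂ k)) rk≡1+x
          in  in-I (π₂ k) state≡ (Equivalence.from (Q-enumerates x y) (π₁ k , Q≡)))
        where
        in-I : ∀ i {y} → state i ≡ suc y → x ≺ y → I x
        in-I (suc i) refl x≺y = i , x≺y

      point : Carrier
      point = from (record { members = I ; enumerated = r , r-enumerates }
                   , LowerSet-ideal ≺-transitive N-ascending)

      ideal-point : ∀ n → ideal point n ⇔ I n
      ideal-point = strictlyInverseˡ _

      point∈A : set point
      point∈A =
        let V , A≡∁V = closed
        -- Membership in a closed set is a negation, so it suffices to refute that the point lies in
        -- the complement `V`.
        in  Equivalence.from (A≡∁V point) λ point∈V →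
              let z , z∈point , z⊆V = basic-is-base (proj₂ V) {point} point∈V
                  i , z≺Ni          = Equivalence.to (ideal-point z) z∈point
                  x , x∈A , Ni∈x    = N-hit i
              in  Equivalence.to (A≡∁V x) x∈A
                    (z⊆V x (RoundedIdeal.lower (ideal-rounded x) Ni∈x z≺Ni))

      choice-⇓ : ∃ λ q → Φ choice αs q × ∃ λ y → δ q y × set y
      choice-⇓ =
        let q , run , δq = proj₂ from-computable r-enumerates
        in  q , (λ n → bind-⇓ (λ { zero → idealCode-⇓ }) (run n)) , point , δq , point∈A

    -- The given point of `A` only shows that the first search halts. Each later `Hit` brings its
    -- own point of `A`, possibly a new one at every step, and none of them enters the computation.
    choice-correct : ∃ set → ∃ λ q → Φ choice αs q × ∃ λ y → δ q y × set y
    choice-correct (x , x∈A) = choice-⇓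
      (λ i → proj₂ (proj₂ (proj₂ (following (proj₂ (sequence i))))))
      (λ i → proj₂ (sequence i))
      (proj₁ (proj₂ first))
      (λ i → proj₁ (proj₂ (following (proj₂ (sequence i)))))
      where
      first : ∃ λ n → αs ⊢ advance ∙ 0 ⇓ suc n × Hit n
      first =
        let y , y∈x               = RoundedIdeal.nonempty (ideal-rounded x)
            -- Directedness applied to `y` twice yields an element above `y`, hence a pair that the
            -- search can find.
            z , z∈x , y≺z , _     = RoundedIdeal.directed (ideal-rounded x) y∈x y∈x
            n , run , n-hit , _   = advance-⇓ 0 (λ _ ()) y≺z (x , x∈A , z∈x)
        in  n , run , n-hit

      following : ∀ {n} → Hit n → ∃ λ m → αs ⊢ advance ∙ suc n ⇓ suc m × Hit m × n ≺ m
      following {n} (x , x∈A , n∈x) =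
        let z , z∈x , n≺z , _     = RoundedIdeal.directed (ideal-rounded x) n∈x n∈x
            m , run , m-hit , n≺m = advance-⇓ (suc n) (λ _ eq → sym (suc-injective eq)) n≺z (x , x∈A , z∈x)
        in  m , run , m-hit , n≺m n refl

      sequence : ℕ → ∃ Hit
      sequence zero    = proj₁ first , proj₂ (proj₂ first)
      sequence (suc i) = let m , _ , m-hit , _ = following (proj₂ (sequence i)) in m , m-hit

theorem20 : ∀ {c ℓ} (X : RepresentedSpace c ℓ) → PrecomputableQuasiPolish X → MultiComputable (𝒱 X) X (VC X)
theorem20 X qp = choice , λ {p} {A} p-names A-inhabited → choice-correct A p-names A-inhabited
  where open OvertChoice X qp
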